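{- Let $K$ be a field, $n\ge1$ an integer, and $E$ a finite directed graph such that $L_K(E)\cong M_n(K)$ as $K$-algebras. Then the number of edges of $E$ is at least $$N_n:=\max\{N\in\mathbb{N}\mid n\ge SP^N_*\}.$$
   Context: A directed graph $E=(E^0,E^1,s,t)$ has vertices $E^0$, edges $E^1$ and source and target maps $s,t\colon E^1\to E^0$ (multiple edges allowed). A finite path of length $m\ge1$ is a tuple $(e_1,\dots,e_m)$ of edges with $t(e_i)=s(e_{i+1})$, ending at $t(e_m)$; vertices are paths of length $0$. A sink is a vertex emitting no edges. Acyclic means there is no path of positive length with equal beginning and end; connected means any two vertices are joined by an undirected path. For $N\in\mathbb{N}$, $SP^N_*$ denotes the maximal number of finite paths ending in the sink, over all connected acyclic directed graphs with exactly $N$ edges and exactly one sink (so $SP^0_*=1$, from a single vertex). For a finite directed graph $E$ and a field $K$, the Leavitt path algebra $L_K(E)$ is the universal associative $K$-algebra generated by $\{v: v\in E^0\}\cup\{e,e^*: e\in E^1\}$ with relations: $vw=\delta_{v,w}v$ for $v,w\in E^0$; $s(e)e=e=e\,t(e)$ and $t(e)e^*=e^*=e^*s(e)$ for $e\in E^1$; $e^*f=\delta_{e,f}t(e)$ for $e,f\in E^1$; and $v=\sum_{e\in s^{ -1}(v)}ee^*$ for every vertex $v$ that is not a sink. -}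

module Defs where

open import Level using (Level; _⊔_; suc)
open import Algebra.Apartness.Bundles using (HeytingField; HeytingCommutativeRing)
open import Algebra.Bundles using (CommutativeRing)
open import Algebra.Module.Bundles using (LeftModule)
open import Algebra.Module.Morphism.Structures using (module LeftModuleMorphisms)
import Algebra.Properties.Semiring.Sum as SemiringSum
open import Algebra.Structures using (IsAbelianGroup; IsRingWithoutOne)
open import Data.Fin using (Fin; _≟_)
open import Data.List using (List; allFin; filter; foldr; map)
open import Data.Nat using (ℕ; _≤_)
open import Data.Product using (∃; ∃!; _×_; _,_; proj₁)
open import Data.Vec.Functional using (Vector)
open import Function.Bundles using (_↔_)
open import Relation.Binary.Construct.Closure.Equivalence using (EqClosure)
open import Relation.Binary.Construct.Closure.ReflexiveTransitive using (Star)
open import Relation.Binary.Construct.Closure.Transitive using (TransClosure)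
open import Relation.Binary.PropositionalEquality using (_≡_; _≢_)
open import Relation.Nullary using (¬_)

record FiniteGraph : Set where
  field
    #vertices : ℕ
    #edges    : ℕ

  Vertex : Set
  Vertex = Fin #vertices

  Edge : Set
  Edge = Fin #edges

  field
    source : Edge → Vertex
    target : Edge → Vertex

module _ (E : FiniteGraph) where
  open FiniteGraph E

  -- Equality proofs between elements of Fin are unique, so an arrow
  -- v ⟶ w is just an edge from v to w, and parallel edges give distinct
  -- arrows.
  Arrow : Vertex → Vertex → Set
  Arrow v w = ∃ λ e → source e ≡ v × target e ≡ w

  Path : Vertex → Vertex → Set
  Path = Star Arrow

  PathEndingIn : Vertex → Set
  PathEndingIn w = ∃ λ v → Path v w

  -- TransClosure Arrow v w consists of the paths of positive length.
  Acyclic : Set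
  Acyclic = ∀ v → ¬ TransClosure Arrow v v

  Connected : Set
  Connected = ∀ v w → EqClosure Arrow v w

  Sink : Vertex → Set
  Sink v = ∀ e → source e ≢ v

  outgoing : Vertex → List Edge
  outgoing v = filter (λ e → source e ≟ v) (allFin #edges)

IsMaximum : (ℕ → Set) → ℕ → Set
IsMaximum P m = P m × (∀ k → P k → k ≤ m)

SinkPathCount : ℕ → ℕ → Set
SinkPathCount N m =
  ∃ λ E → FiniteGraph.#edges E ≡ N
        × Connected E
        × Acyclic E
        × ∃ λ (oneSink : ∃! _≡_ (Sink E)) →
            PathEndingIn E (proj₁ oneSink) ↔ Fin m

-- IsSP* N m says m = SP^N_*.
IsSP* : ℕ → ℕ → Set
IsSP* N = IsMaximum (SinkPathCount N)

-- IsMaxEdges n N says N = max { N ∣ n ≥ SP^N_* }.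
IsMaxEdges : ℕ → ℕ → Set
IsMaxEdges n = IsMaximum (λ N → ∃ λ m → IsSP* N m × m ≤ n)

-- Not required to be unital.
record AssociativeAlgebra {r ℓr : Level} (R : CommutativeRing r ℓr)
                          (a ℓ : Level) : Set (r ⊔ ℓr ⊔ suc (a ⊔ ℓ)) where
  infixl 7 _∙_
  field
    leftModule : LeftModule (CommutativeRing.ring R) a ℓ
  open LeftModule leftModule public
  field
    _∙_              : Carrierᴹ → Carrierᴹ → Carrierᴹ
    isRingWithoutOne : IsRingWithoutOne _≈ᴹ_ _+ᴹ_ _∙_ -ᴹ_ 0ᴹ
    *ₗ-∙-assoc       : ∀ k x y → (k *ₗ x) ∙ y ≈ᴹ k *ₗ (x ∙ y)
    ∙-*ₗ-comm        : ∀ k x y → x ∙ (k *ₗ y) ≈ᴹ k *ₗ (x ∙ y)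

-- Preservation of units is not demanded: a bijective multiplicative map
-- carries a unit to a unit automatically.
record _≅_ {r ℓr a ℓa b ℓb : Level} {R : CommutativeRing r ℓr}
           (A : AssociativeAlgebra R a ℓa) (B : AssociativeAlgebra R b ℓb)
           : Set (r ⊔ a ⊔ ℓa ⊔ b ⊔ ℓb) where
  private
    module A = AssociativeAlgebra A
    module B = AssociativeAlgebra B
  open LeftModuleMorphisms A.rawLeftModule B.rawLeftModule
  field
    ⟦_⟧                     : A.Carrierᴹ → B.Carrierᴹ
    isLeftModuleIsomorphism : IsLeftModuleIsomorphism ⟦_⟧
    ∙-homo                  : ∀ x y → ⟦ x A.∙ y ⟧ B.≈ᴹ ⟦ x ⟧ B.∙ ⟦ y ⟧

-- Classically a Heyting field is exactly a field, with _#_ being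
-- inequality; nontriviality follows from irreflexivity of _#_.
fieldRing : ∀ {c ℓ₁ ℓ₂} → HeytingField c ℓ₁ ℓ₂ → CommutativeRing c ℓ₁
fieldRing K =
  HeytingCommutativeRing.commutativeRing (HeytingField.heytingCommutativeRing K)

module _ {r ℓr : Level} (R : CommutativeRing r ℓr) (n : ℕ) where
  open CommutativeRing R
  open SemiringSum semiring
    using (sum; sum-syntax; sum-cong-≋; ∑-distrib-+; ∑-comm;
           *-distribˡ-sum; *-distribʳ-sum)

  Matrix : Set r
  Matrix = Vector (Vector Carrier n) n

  matrixProduct : Matrix → Matrix → Matrix
  matrixProduct A B i j = ∑[ k < n ] (A i k * B k j)

  matrixAlgebra : AssociativeAlgebra R r ℓr
  matrixAlgebra = record
    { leftModule = record
      { Carrierᴹ = Matrix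
      ; _≈ᴹ_ = λ A B → ∀ i j → A i j ≈ B i j
      ; _+ᴹ_ = λ A B i j → A i j + B i j
      ; _*ₗ_ = λ k A i j → k * A i j
      ; 0ᴹ = λ _ _ → 0#
      ; -ᴹ_ = λ A i j → - A i j
      ; isLeftModule = record
        { isLeftSemimodule = record
          { +ᴹ-isCommutativeMonoid = IsAbelianGroup.isCommutativeMonoid isAbelianGroup
          ; isPreleftSemimodule = record
            { *ₗ-cong = λ k≈l A≈B i j → *-cong k≈l (A≈B i j)
            ; *ₗ-zeroˡ = λ A i j → zeroˡ (A i j)
            ; *ₗ-distribʳ = λ A k l i j → distribʳ (A i j) k l
            ; *ₗ-identityˡ = λ A i j → *-identityˡ (A i j)
            ; *ₗ-assoc = λ k l A i j → *-assoc k l (A i j)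
            ; *ₗ-zeroʳ = λ k i j → zeroʳ k
            ; *ₗ-distribˡ = λ k A B i j → distribˡ k (A i j) (B i j)
            }
          }
        ; -ᴹ‿cong = IsAbelianGroup.⁻¹-cong isAbelianGroup
        ; -ᴹ‿inverse = IsAbelianGroup.inverse isAbelianGroup
        }
      }
    ; _∙_ = matrixProduct
    ; isRingWithoutOne = record
      { +-isAbelianGroup = isAbelianGroup
      ; *-cong = λ A≈B C≈D i j →
          sum-cong-≋ {n} (λ k → *-cong (A≈B i k) (C≈D k j))
      ; *-assoc = λ A B C i j →
          trans (sum-cong-≋ {n} (λ l → *-distribʳ-sum (C l j) (λ k → A i k * B k l)))
          (trans (∑-comm {n} {n} (λ l k → A i k * B k l * C l j))
          (sum-cong-≋ {n} (λ k →
            trans (sum-cong-≋ {n} (λ l → *-assoc (A i k) (B k l) (C l j)))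
                  (sym (*-distribˡ-sum (A i k) (λ l → B k l * C l j))))))
      ; distrib =
          (λ A B C i j →
            trans (sum-cong-≋ {n} (λ k → distribˡ (A i k) (B k j) (C k j)))
                  (∑-distrib-+ {n} (λ k → A i k * B k j) (λ k → A i k * C k j)))
        , (λ A B C i j →
            trans (sum-cong-≋ {n} (λ k → distribʳ (A k j) (B i k) (C i k)))
                  (∑-distrib-+ {n} (λ k → B i k * A k j) (λ k → C i k * A k j)))
      }
    ; *ₗ-∙-assoc = λ k A B i j →
        trans (sum-cong-≋ {n} (λ l → *-assoc k (A i l) (B l j)))
              (sym (*-distribˡ-sum k (λ l → A i l * B l j)))
    ; ∙-*ₗ-comm = λ k A B i j →
        trans (sum-cong-≋ {n} (λ l →
                trans (sym (*-assoc (A i l) k (B l j)))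
                (trans (*-congʳ (*-comm (A i l) k))
                       (*-assoc k (A i l) (B l j)))))
              (sym (*-distribˡ-sum k (λ l → A i l * B l j)))
    }
    where
    isAbelianGroup : IsAbelianGroup (λ (A B : Matrix) → ∀ i j → A i j ≈ B i j)
                       (λ A B i j → A i j + B i j) (λ _ _ → 0#) (λ A i j → - A i j)
    isAbelianGroup = record
      { isGroup = record
        { isMonoid = record
          { isSemigroup = record
            { isMagma = record
              { isEquivalence = record
                { refl = λ i j → refl
                ; sym = λ p i j → sym (p i j)
                ; trans = λ p q i j → trans (p i j) (q i j)
                }
              ; ∙-cong = λ p q i j → +-cong (p i j) (q i j)
              }
            ; assoc = λ A B C i j → +-assoc (A i j) (B i j) (C i j)
            }
          ; identity = (λ A i j → +-identityˡ (A i j))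
                     , (λ A i j → +-identityʳ (A i j))
          }
        ; inverse = (λ A i j → -‿inverseˡ (A i j))
                  , (λ A i j → -‿inverseʳ (A i j))
        ; ⁻¹-cong = λ p i j → -‿cong (p i j)
        }
      ; comm = λ A B i j → +-comm (A i j) (B i j)
      }

module _ {r ℓr : Level} (R : CommutativeRing r ℓr) (E : FiniteGraph) where
  open FiniteGraph E
  private module R = CommutativeRing R

  infixl 7 _⊗_
  infixr 8 _⊙_ ⊖_
  infixl 6 _⊕_
  infix  4 _∼_

  -- Formal expressions in the generators; _∼_ below is the least
  -- congruence imposing the algebra axioms and the defining relations, so
  -- the quotient of LeavittTerm by _∼_ is the universal algebra.
  data LeavittTerm : Set r where
    vertex     : Vertex → LeavittTerm
    edge ghost : Edge → LeavittTerm
    𝟘          : LeavittTerm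
    _⊕_ _⊗_    : LeavittTerm → LeavittTerm → LeavittTerm
    ⊖_         : LeavittTerm → LeavittTerm
    _⊙_        : R.Carrier → LeavittTerm → LeavittTerm

  ∑-outgoing : Vertex → LeavittTerm
  ∑-outgoing v = foldr _⊕_ 𝟘 (map (λ e → edge e ⊗ ghost e) (outgoing E v))

  data _∼_ : LeavittTerm → LeavittTerm → Set (r ⊔ ℓr) where
    ∼-refl  : ∀ {x} → x ∼ x
    ∼-sym   : ∀ {x y} → x ∼ y → y ∼ x
    ∼-trans : ∀ {x y z} → x ∼ y → y ∼ z → x ∼ z

    ⊕-cong : ∀ {x x′ y y′} → x ∼ x′ → y ∼ y′ → x ⊕ y ∼ x′ ⊕ y′
    ⊖-cong : ∀ {x x′} → x ∼ x′ → ⊖ x ∼ ⊖ x′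
    ⊗-cong : ∀ {x x′ y y′} → x ∼ x′ → y ∼ y′ → x ⊗ y ∼ x′ ⊗ y′
    ⊙-cong : ∀ {k k′ x x′} → k R.≈ k′ → x ∼ x′ → k ⊙ x ∼ k′ ⊙ x′

    ⊕-assoc     : ∀ x y z → (x ⊕ y) ⊕ z ∼ x ⊕ (y ⊕ z)
    ⊕-comm      : ∀ x y → x ⊕ y ∼ y ⊕ x
    ⊕-identityˡ : ∀ x → 𝟘 ⊕ x ∼ x
    ⊖-inverseˡ  : ∀ x → ⊖ x ⊕ x ∼ 𝟘

    ⊙-zeroˡ     : ∀ x → R.0# ⊙ x ∼ 𝟘
    ⊙-zeroʳ     : ∀ k → k ⊙ 𝟘 ∼ 𝟘
    ⊙-distribˡ  : ∀ k x y → k ⊙ (x ⊕ y) ∼ k ⊙ x ⊕ k ⊙ y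
    ⊙-distribʳ  : ∀ x k l → (k R.+ l) ⊙ x ∼ k ⊙ x ⊕ l ⊙ x
    ⊙-identityˡ : ∀ x → R.1# ⊙ x ∼ x
    ⊙-assoc     : ∀ k l x → (k R.* l) ⊙ x ∼ k ⊙ (l ⊙ x)

    ⊗-assoc    : ∀ x y z → (x ⊗ y) ⊗ z ∼ x ⊗ (y ⊗ z)
    ⊗-distribˡ : ∀ x y z → x ⊗ (y ⊕ z) ∼ x ⊗ y ⊕ x ⊗ z
    ⊗-distribʳ : ∀ x y z → (y ⊕ z) ⊗ x ∼ y ⊗ x ⊕ z ⊗ x
    ⊙-⊗-assoc  : ∀ k x y → (k ⊙ x) ⊗ y ∼ k ⊙ (x ⊗ y)
    ⊗-⊙-comm   : ∀ k x y → x ⊗ (k ⊙ y) ∼ k ⊙ (x ⊗ y)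

    vertex-idem  : ∀ v → vertex v ⊗ vertex v ∼ vertex v
    vertex-orth  : ∀ {v w} → v ≢ w → vertex v ⊗ vertex w ∼ 𝟘
    source-edge  : ∀ e → vertex (source e) ⊗ edge e ∼ edge e
    edge-target  : ∀ e → edge e ⊗ vertex (target e) ∼ edge e
    target-ghost : ∀ e → vertex (target e) ⊗ ghost e ∼ ghost e
    ghost-source : ∀ e → ghost e ⊗ vertex (source e) ∼ ghost e
    ghost-edge   : ∀ e → ghost e ⊗ edge e ∼ vertex (target e)
    ghost-orth   : ∀ {e f} → e ≢ f → ghost e ⊗ edge f ∼ 𝟘
    vertex-sum   : ∀ v → ¬ Sink E v → vertex v ∼ ∑-outgoing v

  leavittPathAlgebra : AssociativeAlgebra R r (r ⊔ ℓr)
  leavittPathAlgebra = record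
    { leftModule = record
      { _*ₗ_ = _⊙_
      ; isLeftModule = record
        { isLeftSemimodule = record
          { +ᴹ-isCommutativeMonoid = IsAbelianGroup.isCommutativeMonoid isAbelianGroup
          ; isPreleftSemimodule = record
            { *ₗ-cong = ⊙-cong
            ; *ₗ-zeroˡ = ⊙-zeroˡ
            ; *ₗ-distribʳ = ⊙-distribʳ
            ; *ₗ-identityˡ = ⊙-identityˡ
            ; *ₗ-assoc = ⊙-assoc
            ; *ₗ-zeroʳ = ⊙-zeroʳ
            ; *ₗ-distribˡ = ⊙-distribˡ
            }
          }
        ; -ᴹ‿cong = ⊖-cong
        ; -ᴹ‿inverse = IsAbelianGroup.inverse isAbelianGroup
        }
      }
    ; _∙_ = _⊗_
    ; isRingWithoutOne = record
      { +-isAbelianGroup = isAbelianGroup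
      ; *-cong = ⊗-cong
      ; *-assoc = ⊗-assoc
      ; distrib = ⊗-distribˡ , ⊗-distribʳ
      }
    ; *ₗ-∙-assoc = ⊙-⊗-assoc
    ; ∙-*ₗ-comm = ⊗-⊙-comm
    }
    where
    isAbelianGroup : IsAbelianGroup _∼_ _⊕_ 𝟘 ⊖_
    isAbelianGroup = record
      { isGroup = record
        { isMonoid = record
          { isSemigroup = record
            { isMagma = record
              { isEquivalence = record
                { refl = ∼-refl ; sym = ∼-sym ; trans = ∼-trans }
              ; ∙-cong = ⊕-cong
              }
            ; assoc = ⊕-assoc
            }
          ; identity = ⊕-identityˡ
                     , (λ x → ∼-trans (⊕-comm x 𝟘) (⊕-identityˡ x))
          }
        ; inverse = ⊖-inverseˡ
                  , (λ x → ∼-trans (⊕-comm x (⊖ x)) (⊖-inverseˡ x))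
        ; ⁻¹-cong = ⊖-cong
        }
      ; comm = ⊕-comm
      }

{-# OPTIONS --safe #-}
module Submission where

-- Write S(N) for maxPaths N: S(0) = 1, and S(N) is the maximum of
-- 1 + k S(N - k) over 1 ≤ k ≤ N. The proof has two halves:
-- SP^N_* = S(N), and n ≤ S(M) where M is the number of edges of E. As S is
-- strictly increasing and S(0) = 1 ≤ n, there is N with
-- S(N) ≤ n < S(N + 1). This N is the maximum N_n, and S(N) ≤ n ≤ S(M)
-- gives N ≤ M.
--
-- SP^N_* = S(N). Let w be a vertex of an acyclic graph with N edges, k of
-- them ending in w. A nonempty path to w is a path to the source of one of
-- these k edges followed by that edge, and by acyclicity the first part
-- uses none of the k edges. So, inductively, at most 1 + k S(N - k) ≤ S(N)
-- paths end in w (allPaths). Conversely, an optimal graph with N - k edges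
-- becomes one with N edges when its sink is joined by k parallel edges to a
-- new sink (attachSink, optimalGraph).
--
-- n ≤ S(M). Let φ be the isomorphism onto the n by n matrices.
-- * E is acyclic: an infinite path e₁ e₂ ... gives linearly independent
--   elements e₁, e₁e₂, e₁e₂e₃, ... of the Leavitt path algebra, whereas
--   n² + 1 matrices are never independent (noInfinitePath).
-- * For sinks w and w′, every product w t w′ is a scalar multiple of w w′
--   (sink-corner). Hence φ(w) has rank at most one, and φ(w) ≠ 0 for at most
--   one sink w.
-- * Suppose φ(w) ≠ 0 and fix a nonzero column of φ(w), say column b. Let x
--   be a row vector that annihilates column b of φ(α) for every path α
--   ending in w. As φ(α) = φ(α)φ(w) and φ(w) has rank one, xφ(α) = 0. The
--   other sinks are mapped to 0, so xφ(α) = 0 for all paths α ending in a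
--   sink. The relation v = ∑ e e* extends this to all paths, by
--   induction along the acyclic graph; in particular xφ(v) = 0 for all
--   vertices v, whence x annihilates the image of φ, that is, x = 0. So a
--   homogeneous linear system with n unknowns and one equation for each path
--   ending in w has only the zero solution, and n is at most the number of
--   these paths, which is at most S(M).
-- * If φ(w) = 0 for all sinks w, the same induction shows that every x is 0.
--
-- Equality in K need not be decidable. The linear algebra is therefore
-- phrased as "a system with trivial kernel has at least as many equations as
-- unknowns": its conclusion is decidable, so a proof may refute that an entry
-- is apart from zero and conclude by tightness that it is zero.

open import Defs
open import Algebra.Apartness.Bundles using (HeytingField)
import Algebra.Apartness.Properties.HeytingCommutativeRing as HeytingCommutativeRingProperties
open import Algebra.Bundles using (CommutativeRing)
import Algebra.Module.Properties.LeftModule as LeftModuleProperties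
open import Algebra.Module.Morphism.Structures using (module LeftModuleMorphisms)
import Algebra.Properties.CommutativeSemigroup as CommutativeSemigroupProperties
import Algebra.Properties.Ring as RingProperties
import Algebra.Properties.Semiring.Sum as SemiringSum
open import Axiom.UniquenessOfIdentityProofs using (module Decidable⇒UIP)
open import Data.Bool.Base using (if_then_else_)
open import Data.Fin.Base using (Fin; zero; suc; toℕ; punchIn; combine; remQuot; splitAt; _↑ˡ_; _↑ʳ_) renaming (_<_ to _<ᶠ_)
open import Data.Fin.Induction using (spo-wellFounded; spo-noetherian) renaming (<-wellFounded to <ᶠ-wellFounded)
open import Data.Fin.Properties using (_≟_; all?; injective⇒≤; toℕ-injective; punchInᵢ≢i; remQuot-combine; splitAt-↑ˡ; splitAt-↑ʳ; splitAt⁻¹-↑ˡ; splitAt⁻¹-↑ʳ; +↔⊎; *↔×; 1↔⊤) renaming (<-irrefl to <ᶠ-irrefl; <-trans to <ᶠ-trans)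
open import Data.Integer.Base as ℤ using (ℤ; +_)
import Data.Integer.Properties as ℤ
open import Data.List.Base using (List; []; _∷_; _++_; length; lookup; map; filter; foldr; allFin)
open import Data.List.Membership.Propositional using (_∈_)
open import Data.List.Membership.Propositional.Properties using (∈-allFin; ∈-filter⁺; ∈-filter⁻; ∈-map⁺; ∈-++⁺ˡ; ∈-++⁺ʳ)
open import Data.List.Properties using (length-map; length-++; length-tabulate)
open import Data.List.Relation.Unary.All as All using (All; []; _∷_)
open import Data.List.Relation.Unary.All.Properties using (all-filter)
open import Data.List.Relation.Unary.AllPairs using ([]; _∷_)
open import Data.List.Relation.Unary.Any using (here; there; index)
open import Data.List.Relation.Unary.Any.Properties using (lookup-index)
open import Data.List.Relation.Unary.Unique.Propositional using (Unique)
open import Data.List.Relation.Unary.Unique.Propositional.Properties using (allFin⁺; filter⁺)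
open import Data.Nat using (ℕ; _≤_)
open import Data.Nat.Base as Nat using (zero; suc; z≤n; s≤s; _<_)
open import Data.Nat.Induction using (<-rec)
import Data.Nat.Properties as ℕₚ
open import Data.Product using (∃; ∃₂; _×_; _,_; proj₁; proj₂; map₂)
open import Data.Product.Function.NonDependent.Propositional using (_×-↔_)
open import Data.Sum.Base using (_⊎_; inj₁; inj₂; [_,_]′)
open import Data.Sum.Function.Propositional using (_⊎-↔_)
open import Data.Unit.Base using (⊤; tt)
open import Data.Vec.Functional using (Vector; insertAt; removeAt)
open import Data.Vec.Functional.Properties using (insertAt-lookup; insertAt-punchIn)
open import Function.Base using (_∘_; const; flip; id)
open import Function.Bundles using (Injection; Inverse; _↔_; mk↔ₛ′)
open import Function.Construct.Composition using (_↔-∘_)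
open import Function.Construct.Identity using (↔-id)
open import Function.Construct.Symmetry using (↔-sym)
open import Function.Properties.Inverse using (Inverse⇒Injection)
open import Induction.WellFounded using (Acc; acc; WellFounded)
import Level
open import Relation.Binary.Construct.Closure.Equivalence using (EqClosure; symmetric)
open import Relation.Binary.Construct.Closure.ReflexiveTransitive using (ε; _◅_; _◅◅_)
open import Relation.Binary.Construct.Closure.Symmetric using (fwd)
open import Relation.Binary.Construct.Closure.Transitive using (TransClosure; [_]; _∷_; transitive; wellFounded⁻)
open import Relation.Binary.PropositionalEquality as ≡ using (_≡_; _≢_; _≗_)
import Relation.Binary.Reasoning.Setoid as SetoidReasoning
open import Relation.Binary.Structures using (IsStrictPartialOrder)
open import Relation.Nullary using (¬_; Dec; yes; no; does; ¬?; contradiction)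
open import Relation.Unary using (Pred; Decidable)

-- Counting paths in acyclic graphs
module PathCounts where
  open Nat using (_+_; _*_; _⊔_)
  open ℕₚ using (+-suc; +-identityʳ; +-mono-≤; *-identityˡ; m≤n+m; m≤m⊔n; m≤n⊔m; ⊔-sel; ≤-refl; ≤-reflexive; ≤-trans; ≤-<-trans; <⇒≤; <⇒≱; ≰⇒>; _≤?_; m≤n⇒m<n∨m≡n)
  open ≡ using (refl; sym; trans; cong; subst; isEquivalence; resp₂)

  -- The value of SP^N_* as a recursion: in an optimal graph, k parallel edges
  -- lead to the sink from the sink of an optimal graph with N - k edges.
  -- maxSplit k N is the maximum of (k + i) * maxPaths j over i + j = N; the
  -- auxiliary k makes the recursion over the splittings structural.
  mutual
    maxPaths : ℕ → ℕ
    maxPaths zero    = 1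
    maxPaths (suc N) = 1 + maxSplit 1 N

    maxSplit : ℕ → ℕ → ℕ
    maxSplit k zero    = k * maxPaths zero
    maxSplit k (suc N) = (k * maxPaths (suc N)) ⊔ maxSplit (suc k) N

  maxSplit-upper : ∀ k i j → (k + i) * maxPaths j ≤ maxSplit k (i + j)
  maxSplit-upper k zero zero rewrite +-identityʳ k = ≤-refl
  maxSplit-upper k zero (suc j) rewrite +-identityʳ k = m≤m⊔n _ _
  maxSplit-upper k (suc i) j rewrite +-suc k i =
    ≤-trans (maxSplit-upper (suc k) i j) (m≤n⊔m (k * maxPaths (suc (i + j))) _)

  maxSplit-attained : ∀ k N → ∃₂ λ i j → i + j ≡ N × maxSplit k N ≡ (k + i) * maxPaths j
  maxSplit-attained k zero = 0 , 0 , refl , cong (_* 1) (sym (+-identityʳ k))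
  maxSplit-attained k (suc N) with ⊔-sel (k * maxPaths (suc N)) (maxSplit (suc k) N)
  ... | inj₁ eq = 0 , suc N , refl , trans eq (cong (_* maxPaths (suc N)) (sym (+-identityʳ k)))
  ... | inj₂ eq with maxSplit-attained (suc k) N
  ...   | i , j , i+j≡N , max = suc i , j , cong suc i+j≡N ,
            trans eq (trans max (cong (_* maxPaths j) (sym (+-suc k i))))

  maxPaths-upper : ∀ k j → 1 + k * maxPaths j ≤ maxPaths (k + j)
  maxPaths-upper zero    zero    = ≤-refl
  maxPaths-upper zero    (suc j) = s≤s z≤n
  maxPaths-upper (suc k) j       = s≤s (maxSplit-upper 1 k j)

  maxPaths-attained : ∀ N → ∃₂ λ i j → i + j ≡ N × maxPaths (suc N) ≡ 1 + suc i * maxPaths j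
  maxPaths-attained N with maxSplit-attained 1 N
  ... | i , j , eq , max = i , j , eq , cong suc max

  maxPaths-<-suc : ∀ N → maxPaths N < maxPaths (suc N)
  maxPaths-<-suc N =
    subst (λ p → suc p ≤ maxPaths (suc N)) (*-identityˡ (maxPaths N)) (maxPaths-upper 1 N)

  maxPaths-mono : ∀ {M N} → M ≤ N → maxPaths M ≤ maxPaths N
  maxPaths-mono {M} {zero}  z≤n = ≤-refl
  maxPaths-mono {M} {suc N} M≤1+N with m≤n⇒m<n∨m≡n M≤1+N
  ... | inj₁ (s≤s M≤N) = ≤-trans (maxPaths-mono M≤N) (<⇒≤ (maxPaths-<-suc N))
  ... | inj₂ refl      = ≤-refl

  maxPaths-cancel-≤ : ∀ M {N n} → maxPaths M ≤ n → n < maxPaths (suc N) → M ≤ N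
  maxPaths-cancel-≤ M {N} lower upper with M ≤? N
  ... | yes M≤N = M≤N
  ... | no  M≰N = contradiction (≤-trans (maxPaths-mono (≰⇒> M≰N)) lower) (<⇒≱ upper)

  maxPaths-bracket : ∀ n → ∃ λ N → maxPaths N ≤ suc n × suc n < maxPaths (suc N)
  maxPaths-bracket zero = 0 , ≤-refl , maxPaths-<-suc 0
  maxPaths-bracket (suc n) with maxPaths-bracket n
  ... | N , lower , upper with maxPaths (suc N) ≤? suc (suc n)
  ...   | yes next = suc N , next , ≤-<-trans upper (maxPaths-<-suc (suc N))
  ...   | no  next = N , ≤-trans lower (<⇒≤ ≤-refl) , ≰⇒> next

  length-filter-¬ : ∀ {a p} {A : Set a} {P : Pred A p} (P? : Decidable P) xs →
    length (filter P? xs) + length (filter (¬? ∘ P?) xs) ≡ length xs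
  length-filter-¬ P? [] = refl
  length-filter-¬ P? (x ∷ xs) with P? x
  ... | yes _ = cong suc (length-filter-¬ P? xs)
  ... | no  _ = trans (+-suc _ _) (cong suc (length-filter-¬ P? xs))

  -- Positions in the list inject the indices, so the pigeonhole principle applies.
  injection-into-list-≤ : ∀ {a} {A : Set a} {m} (xs : List A) (f : Fin m → A) →
    (∀ {i j} → f i ≡ f j → i ≡ j) → (∀ i → f i ∈ xs) → m ≤ length xs
  injection-into-list-≤ xs f f-injective f∈xs = injective⇒≤ λ {i} {j} eq →
    f-injective (trans (lookup-index (f∈xs i))
                       (trans (cong (lookup xs) eq) (sym (lookup-index (f∈xs j)))))

  -- Upper bound: listing the paths that end in a vertex
  module Paths (E : FiniteGraph) where
    open FiniteGraph E

    module _ (acyclic : Acyclic E) where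

      private
        isStrictPartialOrder : IsStrictPartialOrder _≡_ (TransClosure (Arrow E))
        isStrictPartialOrder = record
          { isEquivalence = isEquivalence
          ; irrefl        = λ { refl cycle → acyclic _ cycle }
          ; trans         = transitive _
          ; <-resp-≈      = resp₂ _
          }

      acyclic⇒wellFounded : WellFounded (Arrow E)
      acyclic⇒wellFounded = wellFounded⁻ _ (spo-wellFounded isStrictPartialOrder)

      acyclic⇒noetherian : WellFounded (flip (TransClosure (Arrow E)))
      acyclic⇒noetherian = spo-noetherian isStrictPartialOrder

    arrow : ∀ e → Arrow E (source e) (target e)
    arrow e = e , refl , refl

    infixl 5 _▻_
    _▻_ : ∀ {v w x} → Path E v w → Arrow E w x → Path E v x
    p ▻ a = p ◅◅ (a ◅ ε)

    -- Paths are built at their beginning, whereas the count peels off the last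
    -- edge.
    data SnocView {w : Vertex} : ∀ {v} → Path E v w → Set where
      empty : SnocView ε
      snoc  : ∀ {u v} (p : Path E v u) (a : Arrow E u w) → SnocView (p ▻ a)

    snocView : ∀ {v w} (p : Path E v w) → SnocView p
    snocView ε = empty
    snocView (a ◅ p) with snocView p
    ... | empty    = snoc ε a
    ... | snoc q b = snoc (a ◅ q) b

    ▻-positive : ∀ {u v w} → Path E u v → Arrow E v w → TransClosure (Arrow E) u w
    ▻-positive ε       b = [ b ]
    ▻-positive (a ◅ p) b = a ∷ ▻-positive p b

    -- The list may repeat paths; its length still bounds their number from above.
    PathEnumeration : Vertex → ℕ → Set
    PathEnumeration w b = ∃ λ (ps : List (PathEndingIn E w)) →
      length ps ≤ b × (∀ {v} (p : Path E v w) → (v , p) ∈ ps)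

    enumerateThrough : ∀ w {b} es → (∀ e → target e ≡ w → PathEnumeration (source e) b) →
      All (λ e → target e ≡ w) es →
      ∃ λ (ps : List (PathEndingIn E w)) → length ps ≤ length es * b ×
        (∀ {v e} → e ∈ es → (t : target e ≡ w) (p : Path E v (source e)) → (v , p ▻ (e , refl , t)) ∈ ps)
    enumerateThrough w [] lists [] = [] , z≤n , λ ()
    enumerateThrough w {b} (e ∷ es) lists (refl ∷ ts) =
      let ps , ps≤ , complete    = lists e refl
          qs , qs≤ , qs-complete = enumerateThrough w es lists ts
          f : PathEndingIn E (source e) → PathEndingIn E w
          f = λ (v , p) → v , p ▻ arrow e
      in map f ps ++ qs
       , ≤-trans (≤-reflexive (trans (length-++ (map f ps)) (cong (_+ length qs) (length-map f ps))))
                 (+-mono-≤ ps≤ qs≤)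
       , λ { (here refl) refl p → ∈-++⁺ˡ (∈-map⁺ f (complete p))
           ; (there e∈es) t p → ∈-++⁺ʳ (map f ps) (qs-complete e∈es t p) }

    -- The list es needs to contain only the edges from which w can be reached.
    -- This is what passes to a predecessor u of w: an edge leading to u cannot end
    -- in w, since it would close a cycle, so the edges into w can be dropped from
    -- es. The length of es thus decreases by the in-degree k of w, matching the
    -- recursion of maxPaths.
    enumeratePaths : Acyclic E → ∀ {w} → Acc (Arrow E) w → (es : List Edge) →
      (∀ e → Path E (target e) w → e ∈ es) → PathEnumeration w (maxPaths (length es))
    enumeratePaths acyclic {w} (acc rec) es es-complete =
      let ps , ps≤ , complete = enumerateThrough w incoming before (all-filter _ es)
          k≤ = subst (λ N → 1 + length incoming * maxPaths (length others) ≤ maxPaths N)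
                     (length-filter-¬ (λ e → target e ≟ w) es)
                     (maxPaths-upper (length incoming) (length others))
          member : ∀ {v} (p : Path E v w) → (v , p) ∈ (w , ε) ∷ ps
          member p = case-snoc ps complete (snocView p)
      in (w , ε) ∷ ps , ≤-trans (s≤s ps≤) k≤ , member
      where
      incoming others : List Edge
      incoming = filter (λ e → target e ≟ w) es
      others   = filter (λ e → ¬? (target e ≟ w)) es

      before : ∀ e → target e ≡ w → PathEnumeration (source e) (maxPaths (length others))
      before e t = enumeratePaths acyclic (rec (e , refl , t)) others λ e′ p →
        ∈-filter⁺ (λ e → ¬? (target e ≟ w)) (es-complete e′ (p ▻ (e , refl , t)))
          λ { refl → acyclic _ (▻-positive p (e , refl , t)) }

      case-snoc : ∀ ps → (∀ {v e} → e ∈ incoming → (t : target e ≡ w) (p : Path E v (source e)) →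
                            (v , p ▻ (e , refl , t)) ∈ ps) →
                  ∀ {v} {p : Path E v w} → SnocView p → (v , p) ∈ (w , ε) ∷ ps
      case-snoc ps complete empty = here refl
      case-snoc ps complete (snoc p (e , refl , t)) =
        there (complete (∈-filter⁺ (λ e → target e ≟ w) (es-complete e (subst (λ u → Path E u w) (sym t) ε)) t) t p)

    allPaths : Acyclic E → ∀ w → PathEnumeration w (maxPaths #edges)
    allPaths acyclic w =
      subst (λ N → PathEnumeration w (maxPaths N)) (length-tabulate {n = #edges} id)
        (enumeratePaths acyclic (acyclic⇒wellFounded acyclic w) (allFin #edges) (λ e _ → ∈-allFin e))

  sinkPathCount⇒≤maxPaths : ∀ {N m} → SinkPathCount N m → m ≤ maxPaths N
  sinkPathCount⇒≤maxPaths (E , refl , _ , acyclic , (w , _) , count) =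
    let ps , ps≤ , complete = Paths.allPaths E acyclic w
    in ≤-trans (injection-into-list-≤ ps (Inverse.from count)
                 (Injection.injective (Inverse⇒Injection (↔-sym count))) (λ i → complete _))
               ps≤

  -- Lower bound: graphs with many paths

  -- Vertices numbered so that edges descend and only vertex zero is a sink.
  -- Acyclicity, connectedness and uniqueness of the sink all follow, so attaching
  -- a new sink preserves them without further work.
  record DescendingGraph (N m : ℕ) : Set where
    field
      {#v}       : ℕ
      src tgt    : Fin N → Fin (suc #v)
      descending : ∀ e → tgt e <ᶠ src e
      emits      : ∀ v → ∃ λ e → src e ≡ suc v

    graph : FiniteGraph
    graph = record { #vertices = suc #v ; #edges = N ; source = src ; target = tgt }

    field
      count : PathEndingIn graph zero ↔ Fin m

  descending⇒sinkPathCount : ∀ {N m} → DescendingGraph N m → SinkPathCount N m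
  descending⇒sinkPathCount G =
    graph , refl , (λ v w → toSink v (<ᶠ-wellFounded v) ◅◅ symmetric _ (toSink w (<ᶠ-wellFounded w)))
    , (λ v cycle → <ᶠ-irrefl refl (path-descends cycle))
    , (zero , sink , unique) , count
    where
    open DescendingGraph G

    arrow-descends : ∀ {v w} → Arrow graph v w → w <ᶠ v
    arrow-descends (e , refl , refl) = descending e

    path-descends : ∀ {v w} → TransClosure (Arrow graph) v w → w <ᶠ v
    path-descends [ a ]   = arrow-descends a
    path-descends (a ∷ p) = <ᶠ-trans (path-descends p) (arrow-descends a)

    toSink : ∀ v → Acc _<ᶠ_ v → EqClosure (Arrow graph) v zero
    toSink zero    _         = ε
    toSink (suc v) (acc rec) with emits v
    ... | e , s = fwd (e , s , refl) ◅ toSink (tgt e) (rec (arrow-descends (e , s , refl)))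

    sink : Sink graph zero
    sink e s with subst (tgt e <ᶠ_) s (descending e)
    ... | ()

    unique : ∀ {v} → Sink graph v → zero ≡ v
    unique {zero}  _       = refl
    unique {suc v} notSink with emits v
    ... | e , s with () ← notSink e s

  singleVertex : DescendingGraph 0 1
  singleVertex = record
    { #v         = 0
    ; src        = λ ()
    ; tgt        = λ ()
    ; descending = λ ()
    ; emits      = λ ()
    ; count      = mk↔ₛ′ (const zero) (const (zero , ε)) (λ { zero → refl })
                     λ { (zero , ε) → refl ; (_ , (() , _) ◅ _) }
    }

  -- Vertices of G move up by one, making room for the new sink zero. The first
  -- suc k edges go from the old sink suc zero to the new one.
  module _ {N m : ℕ} (k : ℕ) (G : DescendingGraph N m) where
    open DescendingGraph G

    private
      sourceOf targetOf : Fin (suc k) ⊎ Fin N → Fin (suc (suc #v))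
      sourceOf = [ const (suc zero) , suc ∘ src ]′
      targetOf = [ const zero , suc ∘ tgt ]′

      src′ tgt′ : Fin (suc k + N) → Fin (suc (suc #v))
      src′ e = sourceOf (splitAt (suc k) e)
      tgt′ e = targetOf (splitAt (suc k) e)

      graph′ : FiniteGraph
      graph′ = record { #vertices = suc (suc #v) ; #edges = suc k + N ; source = src′ ; target = tgt′ }

      descending′ : ∀ e → tgt′ e <ᶠ src′ e
      descending′ e with splitAt (suc k) e
      ... | inj₁ _  = s≤s z≤n
      ... | inj₂ e′ = s≤s (descending e′)

      emits′ : ∀ v → ∃ λ e → src′ e ≡ suc v
      emits′ zero    = zero , refl
      emits′ (suc v) with emits v
      ... | e , s = suc k ↑ʳ e
                  , trans (cong sourceOf (splitAt-↑ʳ (suc k) N e)) (cong suc s)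

      arrow-≡ : ∀ {v w} {a b : Arrow graph′ v w} → proj₁ a ≡ proj₁ b → a ≡ b
      arrow-≡ {a = e , s , t} {b = _ , s′ , t′} refl
        rewrite Decidable⇒UIP.≡-irrelevant _≟_ s s′
              | Decidable⇒UIP.≡-irrelevant _≟_ t t′ = refl

      old : ∀ {u v} → Arrow graph u v → Arrow graph′ (suc u) (suc v)
      old (e , s , t) = suc k ↑ʳ e
        , trans (cong sourceOf (splitAt-↑ʳ (suc k) N e)) (cong suc s)
        , trans (cong targetOf (splitAt-↑ʳ (suc k) N e)) (cong suc t)

      new : Fin (suc k) → Arrow graph′ (suc zero) zero
      new i = i ↑ˡ N
        , cong sourceOf (splitAt-↑ˡ (suc k) i N)
        , cong targetOf (splitAt-↑ˡ (suc k) i N)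

      path-from-zero : ∀ (p : Path graph′ zero zero) → ε ≡ p
      path-from-zero ε = refl
      path-from-zero ((e , s , _) ◅ _) with subst (tgt′ e <ᶠ_) s (descending′ e)
      ... | ()

      -- A path from an old vertex to the new sink is a path to the old sink followed
      -- by one of the new edges.
      split : ∀ {u} → Path graph′ (suc u) zero → Fin (suc k) × Path graph u zero
      split ((e , s , t) ◅ p) with splitAt (suc k) e
      split ((e , refl , refl) ◅ p) | inj₁ i  = i , ε
      split ((e , refl , refl) ◅ p) | inj₂ e′ = map₂ ((e′ , refl , refl) ◅_) (split p)

      -- The next two lemmas compute split on an edge known only up to a proof about
      -- splitAt, because the edges built with ↑ˡ and ↑ʳ do not reduce.
      split-new : ∀ {i} e (s : src′ e ≡ suc zero) (t : tgt′ e ≡ zero) →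
                  splitAt (suc k) e ≡ inj₁ i → split ((e , s , t) ◅ ε) ≡ (i , ε)
      split-new e s t eq with splitAt (suc k) e
      split-new e refl refl refl | inj₁ i = refl

      split-old : ∀ {u v e′} e (s : src′ e ≡ suc u) (t : tgt′ e ≡ suc v) p
                  (s′ : src e′ ≡ u) (t′ : tgt e′ ≡ v) → splitAt (suc k) e ≡ inj₂ e′ →
                  split ((e , s , t) ◅ p) ≡ map₂ ((e′ , s′ , t′) ◅_) (split p)
      split-old e s t p s′ t′ eq with splitAt (suc k) e
      split-old e refl refl p refl refl refl | inj₂ e′ = refl

      unsplit : ∀ {u} → Fin (suc k) × Path graph u zero → Path graph′ (suc u) zero
      unsplit (i , ε)     = new i ◅ ε
      unsplit (i , a ◅ p) = old a ◅ unsplit (i , p)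

      split-unsplit : ∀ {u} i (p : Path graph u zero) → split (unsplit (i , p)) ≡ (i , p)
      split-unsplit i ε = split-new (i ↑ˡ N) _ _ (splitAt-↑ˡ (suc k) i N)
      split-unsplit i ((e , s , t) ◅ p) =
        trans (split-old (suc k ↑ʳ e) _ _ (unsplit (i , p)) s t (splitAt-↑ʳ (suc k) N e))
              (cong (map₂ ((e , s , t) ◅_)) (split-unsplit i p))

      unsplit-split : ∀ {u} (p : Path graph′ (suc u) zero) → unsplit (split p) ≡ p
      unsplit-split ((e , s , t) ◅ p) = go (splitAt (suc k) e) refl s t p
        where
        go : ∀ {e u v} r → splitAt (suc k) e ≡ r → (s : src′ e ≡ suc u) (t : tgt′ e ≡ v)
             (p : Path graph′ v zero) → unsplit (split ((e , s , t) ◅ p)) ≡ (e , s , t) ◅ p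
        go {e} (inj₁ i) eq s t p with splitAt⁻¹-↑ˡ {suc k} {N} {e} eq
        ... | refl with trans (sym (proj₁ (proj₂ (new i)))) s | trans (sym (proj₂ (proj₂ (new i)))) t
        ...   | refl | refl with path-from-zero p
        ...     | refl = trans (cong unsplit (split-new (i ↑ˡ N) s t eq)) (cong (_◅ ε) (arrow-≡ refl))
        go {e} (inj₂ e′) eq s t p with splitAt⁻¹-↑ʳ {suc k} {N} {e} eq
        ... | refl with trans (sym (proj₁ (proj₂ (old (e′ , refl , refl))))) s
                      | trans (sym (proj₂ (proj₂ (old (e′ , refl , refl))))) t
        ...   | refl | refl = trans (cong unsplit (split-old (suc k ↑ʳ e′) s t p refl refl eq))
                  (trans (cong (λ a → a ◅ unsplit (split p)) (arrow-≡ refl))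
                         (cong (_ ◅_) (unsplit-split p)))

      paths : PathEndingIn graph′ zero ↔ (⊤ ⊎ (Fin (suc k) × PathEndingIn graph zero))
      paths = mk↔ₛ′ to from to-from from-to
        where
        to : PathEndingIn graph′ zero → ⊤ ⊎ (Fin (suc k) × PathEndingIn graph zero)
        to (zero  , p) = inj₁ tt
        to (suc u , p) = inj₂ (map₂ (u ,_) (split p))

        from : ⊤ ⊎ (Fin (suc k) × PathEndingIn graph zero) → PathEndingIn graph′ zero
        from (inj₁ tt)          = zero , ε
        from (inj₂ (i , u , p)) = suc u , unsplit (i , p)

        to-from : ∀ x → to (from x) ≡ x
        to-from (inj₁ tt)          = refl
        to-from (inj₂ (i , u , p)) = cong (inj₂ ∘ map₂ (u ,_)) (split-unsplit i p)

        from-to : ∀ p → from (to p) ≡ p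
        from-to (zero  , p) = cong (zero ,_) (path-from-zero p)
        from-to (suc u , p) = cong (suc u ,_) (unsplit-split p)

    attachSink : DescendingGraph (suc k + N) (1 + suc k * m)
    attachSink = record
      { src        = src′
      ; tgt        = tgt′
      ; descending = descending′
      ; emits      = emits′
      ; count      = ↔-sym (+↔⊎ {1} {suc k * m})
          ↔-∘ ((↔-sym 1↔⊤ ⊎-↔ (↔-sym *↔× ↔-∘ (↔-id _ ×-↔ count)))
          ↔-∘ paths)
      }

  optimalGraph : ∀ N → DescendingGraph N (maxPaths N)
  optimalGraph = <-rec _ build
    where
    build : ∀ N → (∀ {j} → j < N → DescendingGraph j (maxPaths j)) → DescendingGraph N (maxPaths N)
    build zero    _   = singleVertex
    build (suc N) rec with maxPaths-attained N
    ... | i , j , refl , max = subst (DescendingGraph (suc N)) (sym max) (attachSink i (rec (s≤s (m≤n+m j i))))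

  isSP*-maxPaths : ∀ N → IsSP* N (maxPaths N)
  isSP*-maxPaths N = descending⇒sinkPathCount (optimalGraph N) , λ m → sinkPathCount⇒≤maxPaths

-- Linear algebra over a Heyting field
module LinearAlgebra {c ℓ₁ ℓ₂} (K : HeytingField c ℓ₁ ℓ₂) where
  open CommutativeRing (fieldRing K) hiding (zero)
  open HeytingField K using (_#_; tight; #-irrefl; #⇒invertible; heytingCommutativeRing)
  open HeytingCommutativeRingProperties heytingCommutativeRing using (1#0; x-0≈x)
  open RingProperties ring using (-‿distribˡ-*)
  open SemiringSum semiring using (sum; sum-syntax; sum-cong-≋; sum-remove; sum-replicate-zero; ∑-distrib-+; *-distribˡ-sum)
  open CommutativeSemigroupProperties *-commutativeSemigroup using (x∙yz≈y∙xz; xy∙z≈xz∙y)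
  open SetoidReasoning setoid

  1≉0 : ¬ (1# ≈ 0#)
  1≉0 1≈0 = #-irrefl 1≈0 1#0

  invertible : ∀ {x} → x # 0# → ∃ λ y → y * x ≈ 1#
  invertible {x} x#0 with #⇒invertible x#0
  ... | y , y[x-0]≈1 , _ = y , trans (*-congˡ (sym (x-0≈x x))) y[x-0]≈1

  sum-zero : ∀ {n} {t : Vector Carrier n} → (∀ i → t i ≈ 0#) → sum t ≈ 0#
  sum-zero {n} t≈0 = trans (sum-cong-≋ t≈0) (sum-replicate-zero n)

  sum-single : ∀ {n} {t : Vector Carrier n} i → (∀ k → k ≢ i → t k ≈ 0#) → sum t ≈ t i
  sum-single {suc n} {t} i others = begin
    sum t                      ≈⟨ sum-remove t ⟩
    t i + sum (removeAt t i)   ≈⟨ +-congˡ (sum-zero λ k → others _ (punchInᵢ≢i i k)) ⟩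
    t i + 0#                   ≈⟨ +-identityʳ _ ⟩
    t i                        ∎

  δ : ∀ {n} → Fin n → Fin n → Carrier
  δ i j = if does (i ≟ j) then 1# else 0#

  sum-δʳ : ∀ {n} (t : Vector Carrier n) i → ∑[ k < n ] (t k * δ k i) ≈ t i
  sum-δʳ t i = trans (sum-single i off) on
    where
    off : ∀ k → k ≢ i → t k * δ k i ≈ 0#
    off k k≢i with k ≟ i
    ... | yes k≡i = contradiction k≡i k≢i
    ... | no  _   = zeroʳ _
    on : t i * δ i i ≈ t i
    on with i ≟ i
    ... | yes _   = *-identityʳ _
    ... | no  i≢i = contradiction ≡.refl i≢i

  -- The rows of A are homogeneous equations in n unknowns. Systems obtained by
  -- elimination inherit a trivial kernel, so no nonzero solution is ever searched
  -- for, which would require deciding whether entries vanish.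
  TrivialKernel : ∀ {p n} → (Fin p → Vector Carrier n) → Set (c Level.⊔ ℓ₁)
  TrivialKernel {n = n} A =
    ∀ (x : Vector Carrier n) → (∀ j → ∑[ i < n ] (x i * A j i) ≈ 0#) → ∀ i → x i ≈ 0#

  -- Gaussian elimination of unknown i by means of equation zero, whose coefficient
  -- a there has inverse b.
  module Pivot {p n : ℕ} (A : Fin (suc p) → Vector Carrier (suc n)) (i : Fin (suc n))
               (b : Carrier) (b*a≈1 : b * A zero i ≈ 1#) where

    factor : Fin p → Carrier
    factor j = - (b * A (suc j) i)

    eliminated : Fin p → Vector Carrier n
    eliminated j k = A (suc j) (punchIn i k) + factor j * A zero (punchIn i k)

    module _ (x : Vector Carrier n) where
      rest : Fin (suc p) → Carrier
      rest j = ∑[ k < n ] (x k * A j (punchIn i k))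

      extended : Vector Carrier (suc n)
      extended = insertAt x i (- (b * rest zero))

      extended-row : ∀ j → ∑[ l < suc n ] (extended l * A j l) ≈ - (b * rest zero) * A j i + rest j
      extended-row j = trans (sum-remove {i = i} (λ l → extended l * A j l))
        (+-cong (*-congʳ (reflexive (insertAt-lookup x i _)))
                (sum-cong-≋ λ k → *-congʳ (reflexive (insertAt-punchIn x i _ k))))

      swap : ∀ j → - (b * rest zero) * A j i ≈ - (b * A j i) * rest zero
      swap j = begin
        - (b * rest zero) * A j i   ≈⟨ -‿distribˡ-* _ _ ⟨
        - (b * rest zero * A j i)   ≈⟨ -‿cong (xy∙z≈xz∙y b (rest zero) (A j i)) ⟩
        - (b * A j i * rest zero)   ≈⟨ -‿distribˡ-* _ _ ⟩
        - (b * A j i) * rest zero   ∎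

      extended-kernel : (∀ j → ∑[ k < n ] (x k * eliminated j k) ≈ 0#) →
                        ∀ j → ∑[ l < suc n ] (extended l * A j l) ≈ 0#
      extended-kernel x∈ker zero = begin
        _                                        ≈⟨ extended-row zero ⟩
        - (b * rest zero) * A zero i + rest zero ≈⟨ +-congʳ (swap zero) ⟩
        - (b * A zero i) * rest zero + rest zero ≈⟨ +-congʳ (-‿distribˡ-* _ _) ⟨
        - (b * A zero i * rest zero) + rest zero ≈⟨ +-congʳ (-‿cong (trans (*-congʳ b*a≈1) (*-identityˡ _))) ⟩
        - rest zero + rest zero                  ≈⟨ -‿inverseˡ _ ⟩
        0#                                       ∎
      extended-kernel x∈ker (suc j) = begin
        _                                                   ≈⟨ extended-row (suc j) ⟩
        - (b * rest zero) * A (suc j) i + rest (suc j)      ≈⟨ +-congʳ (swap (suc j)) ⟩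
        factor j * rest zero + rest (suc j)                 ≈⟨ +-comm _ _ ⟩
        rest (suc j) + factor j * rest zero                 ≈⟨ +-congˡ (*-distribˡ-sum (factor j) (λ k → x k * A zero (punchIn i k))) ⟩
        rest (suc j) + ∑[ k < n ] (factor j * (x k * A zero (punchIn i k)))
          ≈⟨ +-congˡ (sum-cong-≋ λ k → x∙yz≈y∙xz (factor j) (x k) (A zero (punchIn i k))) ⟩
        rest (suc j) + ∑[ k < n ] (x k * (factor j * A zero (punchIn i k)))
          ≈⟨ ∑-distrib-+ (λ k → x k * A (suc j) (punchIn i k)) _ ⟨
        ∑[ k < n ] (x k * A (suc j) (punchIn i k) + x k * (factor j * A zero (punchIn i k)))
          ≈⟨ sum-cong-≋ (λ k → distribˡ (x k) _ _) ⟨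
        ∑[ k < n ] (x k * eliminated j k)                   ≈⟨ x∈ker j ⟩
        0#                                                  ∎

    eliminated-trivial : TrivialKernel A → TrivialKernel eliminated
    eliminated-trivial trivial x x∈ker k =
      trans (reflexive (≡.sym (insertAt-punchIn x i _ k)))
            (trivial (extended x) (extended-kernel x x∈ker) (punchIn i k))

  -- If n ≤ p failed, no coefficient of the first equation could be apart from
  -- zero, since eliminating with it would leave a smaller system with trivial
  -- kernel. By tightness that equation is then trivial and can be dropped.
  trivialKernel⇒≤ : ∀ {p n} (A : Fin p → Vector Carrier n) → TrivialKernel A → n ≤ p
  trivialKernel⇒≤ {p} {zero} A trivial = z≤n
  trivialKernel⇒≤ {zero} {suc n} A trivial = contradiction (trivial (λ _ → 1#) (λ ()) zero) 1≉0
  trivialKernel⇒≤ {suc p} {suc n} A trivial with suc n ℕₚ.≤? suc p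
  ... | yes n≤p = n≤p
  ... | no  n≰p = ℕₚ.m≤n⇒m≤1+n (trivialKernel⇒≤ (A ∘ suc) λ x x∈ker →
                    trivial x λ { zero    → sum-zero λ i → trans (*-congˡ (row₀≈0 i)) (zeroʳ (x i))
                                ; (suc j) → x∈ker j })
    where
    row₀≈0 : ∀ i → A zero i ≈ 0#
    row₀≈0 i = proj₁ (tight _ _) λ pivot#0 →
      let b , b*a≈1 = invertible pivot#0
          open Pivot A i b b*a≈1
      in n≰p (s≤s (trivialKernel⇒≤ eliminated (eliminated-trivial trivial)))

-- Infinite paths and linear independence
module InfinitePaths (E : FiniteGraph) where
  open FiniteGraph E

  IsInfinitePath : (ℕ → Edge) → Set
  IsInfinitePath z = ∀ i → target (z i) ≡ source (z (suc i))

  module _ {v : Vertex} (cycle : TransClosure (Arrow E) v v) where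
    private
      -- The part of the current round around the cycle that still lies ahead.
      State : Set
      State = ∃ λ u → TransClosure (Arrow E) u v

      current : State → Edge
      current (_ , [ e , _ ])     = e
      current (_ , (e , _) ∷ _) = e

      next : State → State
      next (_ , [ _ ])   = v , cycle
      next (_ , _ ∷ p) = _ , p

      source-current : ∀ s → source (current s) ≡ proj₁ s
      source-current (_ , [ _ , s , _ ])     = s
      source-current (_ , (_ , s , _) ∷ _) = s

      target-current : ∀ s → target (current s) ≡ proj₁ (next s)
      target-current (_ , [ _ , _ , t ])     = t
      target-current (_ , (_ , _ , t) ∷ _) = t

      state : ℕ → State
      state zero    = v , cycle
      state (suc i) = next (state i)

    cycle⇒infinitePath : ∃ IsInfinitePath
    cycle⇒infinitePath = current ∘ state , λ i →
      ≡.trans (target-current (state i)) (≡.sym (source-current (state (suc i))))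

-- The Leavitt path algebra acts on functions on the space of infinite paths times
-- the integers: an edge restricts to paths that begin with it and removes it, a
-- ghost edge prepends it. The integer counts removed edges; it distinguishes
-- monomials of different degree that would act alike on a periodic path.
module InfinitePathModule {r ℓr} (R : CommutativeRing r ℓr) (E : FiniteGraph) where
  open InfinitePaths E using (IsInfinitePath)
  open CommutativeRing R hiding (zero)
  open FiniteGraph E
  open SemiringSum semiring using (sum-syntax)
  open RingProperties ring using (-‿+-comm; -‿distribʳ-*)
  open CommutativeSemigroupProperties +-commutativeSemigroup using (interchange)
  open CommutativeSemigroupProperties *-commutativeSemigroup using (x∙yz≈y∙xz)

  Term : Set r
  Term = LeavittTerm R E

  -- Arbitrary edge sequences are allowed as arguments, and validity and pointwise
  -- equality of sequences enter through the relations on functions below.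
  Function : Set r
  Function = (ℕ → Edge) → ℤ → Carrier

  infixr 5 _◂_
  _◂_ : Edge → (ℕ → Edge) → ℕ → Edge
  (e ◂ z) zero    = e
  (e ◂ z) (suc i) = z i

  guard : ∀ {p} {P : Set p} → Dec P → Carrier → Carrier
  guard P? x = if does P? then x else 0#

  act : Term → Function → Function
  act (vertex v) f z d = guard (v ≟ source (z 0)) (f z d)
  act (edge e)   f z d = guard (z 0 ≟ e) (f (z ∘ suc) (ℤ.suc d))
  act (ghost e)  f z d = guard (target e ≟ source (z 0)) (f (e ◂ z) (ℤ.pred d))
  act 𝟘          f z d = 0#
  act (x ⊕ y)    f z d = act x f z d + act y f z d
  act (x ⊗ y)    f     = act x (act y f)
  act (⊖ x)      f z d = - act x f z d
  act (k ⊙ x)    f z d = k * act x f z d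

  ◂-isInfinitePath : ∀ {e z} → target e ≡ source (z 0) → IsInfinitePath z → IsInfinitePath (e ◂ z)
  ◂-isInfinitePath t z∞ zero    = t
  ◂-isInfinitePath t z∞ (suc i) = z∞ i

  ◂-cong : ∀ e {z z′} → z ≗ z′ → e ◂ z ≗ e ◂ z′
  ◂-cong e z≗z′ zero    = ≡.refl
  ◂-cong e z≗z′ (suc i) = z≗z′ i

  ◂-η : ∀ z → z 0 ◂ (z ∘ suc) ≗ z
  ◂-η z zero    = ≡.refl
  ◂-η z (suc i) = ≡.refl

  guard-yes : ∀ {p} {P : Set p} (P? : Dec P) {x} → P → guard P? x ≈ x
  guard-yes (yes _) _ = refl
  guard-yes (no ¬p) p = contradiction p ¬p

  guard-no : ∀ {p} {P : Set p} (P? : Dec P) {x} → ¬ P → guard P? x ≈ 0#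
  guard-no (yes p) ¬p = contradiction p ¬p
  guard-no (no _)  _  = refl

  guard-zero : ∀ {p} {P : Set p} (P? : Dec P) {x} → (P → x ≈ 0#) → guard P? x ≈ 0#
  guard-zero (yes p) x≈0 = x≈0 p
  guard-zero (no _)  _   = refl

  -- The action is linear and respects pointwise equality of paths. Both are
  -- instances of one induction on terms (act-related): the action preserves every
  -- relation between function values that is closed under linear operations.
  Related : (Carrier → Carrier → Carrier → Set ℓr) → Function → Function → Function → Set ℓr
  Related T f g h =
    ∀ {z z′} → IsInfinitePath z → z ≗ z′ → ∀ d → T (f z d) (g z′ d) (h z′ d)

  record LinearRelation (T : Carrier → Carrier → Carrier → Set ℓr) : Set (r Level.⊔ ℓr) where
    field
      T-0 : T 0# 0# 0#
      T-+ : ∀ {x y z x′ y′ z′} → T x y z → T x′ y′ z′ → T (x + x′) (y + y′) (z + z′)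
      T-- : ∀ {x y z} → T x y z → T (- x) (- y) (- z)
      T-* : ∀ k {x y z} → T x y z → T (k * x) (k * y) (k * z)

  module _ {T : Carrier → Carrier → Carrier → Set ℓr} (linear : LinearRelation T) where
    open LinearRelation linear

    guard-related : ∀ {p} {P : Set p} (P? : Dec P) {x y z} →
      (P → T x y z) → T (guard P? x) (guard P? y) (guard P? z)
    guard-related (yes p) xyz = xyz p
    guard-related (no _)  _   = T-0

    act-related : ∀ x {f g h} → Related T f g h → Related T (act x f) (act x g) (act x h)
    act-related (vertex v) fgh {z} z∞ z≗ d rewrite ≡.sym (z≗ 0) =
      guard-related (v ≟ source (z 0)) λ _ → fgh z∞ z≗ d
    act-related (edge e) fgh {z} z∞ z≗ d rewrite ≡.sym (z≗ 0) =
      guard-related (z 0 ≟ e) λ _ → fgh (z∞ ∘ suc) (z≗ ∘ suc) _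
    act-related (ghost e) fgh {z} z∞ z≗ d rewrite ≡.sym (z≗ 0) =
      guard-related (target e ≟ source (z 0)) λ t → fgh (◂-isInfinitePath t z∞) (◂-cong e z≗) _
    act-related 𝟘       fgh z∞ z≗ d = T-0
    act-related (x ⊕ y) fgh z∞ z≗ d = T-+ (act-related x fgh z∞ z≗ d) (act-related y fgh z∞ z≗ d)
    act-related (x ⊗ y) fgh = act-related x (act-related y fgh)
    act-related (⊖ x)   fgh z∞ z≗ d = T-- (act-related x fgh z∞ z≗ d)
    act-related (k ⊙ x) fgh z∞ z≗ d = T-* k (act-related x fgh z∞ z≗ d)

  equal : LinearRelation (λ x y _ → x ≈ y)
  equal = record { T-0 = refl ; T-+ = +-cong ; T-- = -‿cong ; T-* = λ k → *-congˡ }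

  isSum : LinearRelation (λ x y z → x ≈ y + z)
  isSum = record
    { T-0 = sym (+-identityˡ 0#)
    ; T-+ = λ p q → trans (+-cong p q) (interchange _ _ _ _)
    ; T-- = λ p → trans (-‿cong p) (sym (-‿+-comm _ _))
    ; T-* = λ k p → trans (*-congˡ p) (distribˡ k _ _)
    }

  isMultiple : ∀ l → LinearRelation (λ x y _ → x ≈ l * y)
  isMultiple l = record
    { T-0 = sym (zeroʳ l)
    ; T-+ = λ p q → trans (+-cong p q) (sym (distribˡ l _ _))
    ; T-- = λ p → trans (-‿cong p) (-‿distribʳ-* l _)
    ; T-* = λ k p → trans (*-congˡ p) (x∙yz≈y∙xz k l _)
    }

  infix 4 _≋_
  _≋_ : Function → Function → Set ℓr
  f ≋ g = Related (λ x y _ → x ≈ y) f g g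

  act-cong : ∀ x {f g} → f ≋ g → act x f ≋ act x g
  act-cong x {f} {g} f≋g = act-related equal x {f} {g} {g} f≋g

  module _ {f : Function} {z : ℕ → Edge} {d : ℤ} (h : Edge → Term) where

    act-∑-zero : ∀ es → (∀ {e} → e ∈ es → act (h e) f z d ≈ 0#) →
      act (foldr _⊕_ 𝟘 (map h es)) f z d ≈ 0#
    act-∑-zero []       zeros = refl
    act-∑-zero (e ∷ es) zeros =
      trans (+-cong (zeros (here ≡.refl)) (act-∑-zero es (zeros ∘ there))) (+-identityˡ 0#)

    -- At most one outgoing edge is the first edge of a given path.
    act-∑-single : ∀ {e₀ es} → Unique es → e₀ ∈ es → (∀ {e} → e₀ ≢ e → act (h e) f z d ≈ 0#) →
      act (foldr _⊕_ 𝟘 (map h es)) f z d ≈ act (h e₀) f z d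
    act-∑-single {es = _ ∷ es} (e₀∉es ∷ _) (here ≡.refl) others =
      trans (+-congˡ (act-∑-zero es λ e∈es → others (All.lookup e₀∉es e∈es))) (+-identityʳ _)
    act-∑-single (e∉es ∷ unique) (there e₀∈es) others =
      trans (+-cong (others λ { ≡.refl → All.lookup e∉es e₀∈es ≡.refl }) (act-∑-single unique e₀∈es others))
            (+-identityˡ _)

  -- Only functions with f ≋ f, those respecting pointwise equality of paths,
  -- are considered: the relation vertex-sum requires that removing the first edge
  -- of a path and prepending it again leaves f unchanged.
  act-sound : ∀ {x y} → _∼_ R E x y → ∀ {f} → f ≋ f → ∀ {z} → IsInfinitePath z → ∀ d →
              act x f z d ≈ act y f z d
  act-sound ∼-refl f≋f z∞ d = refl
  act-sound (∼-sym p) f≋f z∞ d = sym (act-sound p f≋f z∞ d)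
  act-sound (∼-trans p q) f≋f z∞ d = trans (act-sound p f≋f z∞ d) (act-sound q f≋f z∞ d)
  act-sound (⊕-cong p q) f≋f z∞ d = +-cong (act-sound p f≋f z∞ d) (act-sound q f≋f z∞ d)
  act-sound (⊖-cong p) f≋f z∞ d = -‿cong (act-sound p f≋f z∞ d)
  act-sound (⊗-cong {x} {x′} {y} {y′} p q) f≋f z∞ d =
    trans (act-sound p (act-cong y f≋f) z∞ d)
          (act-cong x′ (λ z∞ z≗ d → trans (act-sound q f≋f z∞ d) (act-cong y′ f≋f z∞ z≗ d)) z∞ (λ _ → ≡.refl) d)
  act-sound (⊙-cong k≈l p) f≋f z∞ d = *-cong k≈l (act-sound p f≋f z∞ d)
  act-sound (⊕-assoc x y z) f≋f z∞ d = +-assoc _ _ _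
  act-sound (⊕-comm x y) f≋f z∞ d = +-comm _ _
  act-sound (⊕-identityˡ x) f≋f z∞ d = +-identityˡ _
  act-sound (⊖-inverseˡ x) f≋f z∞ d = -‿inverseˡ _
  act-sound (⊙-zeroˡ x) f≋f z∞ d = zeroˡ _
  act-sound (⊙-zeroʳ k) f≋f z∞ d = zeroʳ k
  act-sound (⊙-distribˡ k x y) f≋f z∞ d = distribˡ k _ _
  act-sound (⊙-distribʳ x k l) f≋f z∞ d = distribʳ _ k l
  act-sound (⊙-identityˡ x) f≋f z∞ d = *-identityˡ _
  act-sound (⊙-assoc k l x) f≋f z∞ d = *-assoc k l _
  act-sound (⊗-assoc x y z) f≋f z∞ d = refl
  act-sound (⊗-distribˡ x y y′) f≋f z∞ d =
    act-related isSum x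
      (λ z∞ z≗ d → +-cong (act-cong y f≋f z∞ z≗ d) (act-cong y′ f≋f z∞ z≗ d)) z∞ (λ _ → ≡.refl) d
  act-sound (⊗-distribʳ x y z) f≋f z∞ d = refl
  act-sound (⊙-⊗-assoc k x y) f≋f z∞ d = refl
  act-sound (⊗-⊙-comm k x y) f≋f z∞ d =
    act-related (isMultiple k) x {h = λ _ _ → 0#}
      (λ z∞ z≗ d → *-congˡ (act-cong y f≋f z∞ z≗ d)) z∞ (λ _ → ≡.refl) d
  act-sound (vertex-idem v) f≋f {z} z∞ d with v ≟ source (z 0)
  ... | yes _ = refl
  ... | no _  = refl
  act-sound (vertex-orth {v} {w} v≢w) f≋f {z} z∞ d = guard-zero (v ≟ source (z 0))
    λ v≡ → guard-no (w ≟ source (z 0)) λ w≡ → v≢w (≡.trans v≡ (≡.sym w≡))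
  act-sound (source-edge e) f≋f {z} z∞ d with z 0 ≟ e
  ... | yes ≡.refl = guard-yes (source e ≟ source e) ≡.refl
  ... | no  _      = guard-zero (source e ≟ source (z 0)) λ _ → refl
  act-sound (edge-target e) f≋f {z} z∞ d with z 0 ≟ e
  ... | yes ≡.refl = guard-yes (target e ≟ source (z 1)) (z∞ 0)
  ... | no  _      = refl
  act-sound (target-ghost e) f≋f {z} z∞ d with target e ≟ source (z 0)
  ... | yes _ = refl
  ... | no _  = refl
  act-sound (ghost-source e) f≋f {z} z∞ d with target e ≟ source (z 0)
  ... | yes _ = guard-yes (source e ≟ source e) ≡.refl
  ... | no _  = refl
  act-sound (ghost-edge e) {f} f≋f {z} z∞ d with target e ≟ source (z 0)
  ... | no _  = refl
  ... | yes _ = trans (guard-yes (e ≟ e) ≡.refl) (reflexive (≡.cong (f z) (ℤ.suc-pred d)))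
  act-sound (ghost-orth {e} {f} e≢f) f≋f {z} z∞ d = guard-zero (target e ≟ source (z 0))
    λ _ → guard-no (e ≟ f) e≢f
  act-sound (vertex-sum v _) {f} f≋f {z} z∞ d with v ≟ source (z 0)
  ... | yes v≡ = sym (trans (act-∑-single _ (filter⁺ _ (allFin⁺ #edges))
                              (∈-filter⁺ (λ e → source e ≟ v) (∈-allFin (z 0)) (≡.sym v≡))
                              (λ {e} → guard-no (z 0 ≟ e)))
                     (trans (guard-yes (z 0 ≟ z 0) ≡.refl)
                     (trans (guard-yes (target (z 0) ≟ source (z 1)) (z∞ 0))
                     (trans (reflexive (≡.cong (f _) (ℤ.pred-suc d)))
                            (f≋f (◂-isInfinitePath (z∞ 0) (z∞ ∘ suc)) (◂-η z) d)))))
  ... | no v≢ = sym (act-∑-zero _ (outgoing E v) λ {e} e∈ → guard-no (z 0 ≟ e)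
                  λ { ≡.refl → v≢ (≡.sym (proj₂ (∈-filter⁻ (λ e → source e ≟ v) {xs = allFin #edges} e∈))) })

  prefix : (ℕ → Edge) → ℕ → Term
  prefix z zero    = edge (z 0)
  prefix z (suc i) = edge (z 0) ⊗ prefix (z ∘ suc) i

  -- A prefix of length i + 1 raises the degree by i + 1, which separates the
  -- prefixes of one path.
  act-prefix : ∀ (h : ℤ → Carrier) z i d → act (prefix z i) (λ _ → h) z (+ d) ≈ h (+ (suc i Nat.+ d))
  act-prefix h z zero    d = guard-yes (z 0 ≟ z 0) ≡.refl
  act-prefix h z (suc i) d = trans (guard-yes (z 0 ≟ z 0) ≡.refl)
    (trans (act-prefix h (z ∘ suc) i (suc d)) (reflexive (≡.cong (h ∘ +_) (≡.cong suc (ℕₚ.+-suc i d)))))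

  combination : ∀ {m} → Vector Carrier m → Vector Term m → Term
  combination {zero}  x t = 𝟘
  combination {suc m} x t = x zero ⊙ t zero ⊕ combination (x ∘ suc) (t ∘ suc)

  act-combination : ∀ {m} (x : Vector Carrier m) t f z d →
    act (combination x t) f z d ≈ ∑[ i < m ] (x i * act (t i) f z d)
  act-combination {zero}  x t f z d = refl
  act-combination {suc m} x t f z d = +-congˡ (act-combination (x ∘ suc) (t ∘ suc) f z d)


-- Corners of the Leavitt path algebra at sinks
module LeavittProperties {r ℓr} (R : CommutativeRing r ℓr) (E : FiniteGraph) where
  open FiniteGraph E
  open PathCounts.Paths E using (_▻_)
  private module R = CommutativeRing R
  open AssociativeAlgebra (leavittPathAlgebra R E) using (leftModule; _≈ᴹ_; ≈ᴹ-setoid) public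
  open LeftModuleProperties leftModule using (inverseˡ-uniqueᴹ)
  open SetoidReasoning ≈ᴹ-setoid

  private Term = LeavittTerm R E

  ⊖-as-⊙ : ∀ x → ⊖ x ≈ᴹ (R.- R.1#) ⊙ x
  ⊖-as-⊙ x = ∼-sym (inverseˡ-uniqueᴹ _ _ (begin
    (R.- R.1#) ⊙ x ⊕ x            ≈⟨ ⊕-cong ∼-refl (⊙-identityˡ x) ⟨
    (R.- R.1#) ⊙ x ⊕ R.1# ⊙ x     ≈⟨ ⊙-distribʳ x _ _ ⟨
    (R.- R.1# R.+ R.1#) ⊙ x       ≈⟨ ⊙-cong (R.-‿inverseˡ R.1#) ∼-refl ⟩
    R.0# ⊙ x                      ≈⟨ ⊙-zeroˡ x ⟩
    𝟘                             ∎))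

  ⊗-zeroʳ : ∀ x → x ⊗ 𝟘 ≈ᴹ 𝟘
  ⊗-zeroʳ x = begin
    x ⊗ 𝟘            ≈⟨ ⊗-cong ∼-refl (⊙-zeroˡ 𝟘) ⟨
    x ⊗ (R.0# ⊙ 𝟘)   ≈⟨ ⊗-⊙-comm R.0# x 𝟘 ⟩
    R.0# ⊙ (x ⊗ 𝟘)   ≈⟨ ⊙-zeroˡ _ ⟩
    𝟘                ∎

  ⊗-zeroˡ : ∀ x → 𝟘 ⊗ x ≈ᴹ 𝟘
  ⊗-zeroˡ x = begin
    𝟘 ⊗ x            ≈⟨ ⊗-cong (⊙-zeroˡ 𝟘) ∼-refl ⟨
    (R.0# ⊙ 𝟘) ⊗ x   ≈⟨ ⊙-⊗-assoc R.0# 𝟘 x ⟩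
    R.0# ⊙ (𝟘 ⊗ x)   ≈⟨ ⊙-zeroˡ _ ⟩
    𝟘                ∎

  -- The idempotents between the factors are orthogonal.
  mismatch : ∀ {u v x y} → u ≢ v → x ⊗ vertex u ≈ᴹ x → vertex v ⊗ y ≈ᴹ y → x ⊗ y ≈ᴹ 𝟘
  mismatch {u} {v} {x} {y} u≢v x≈ y≈ = begin
    x ⊗ y                          ≈⟨ ⊗-cong x≈ y≈ ⟨
    (x ⊗ vertex u) ⊗ (vertex v ⊗ y) ≈⟨ ⊗-assoc x _ _ ⟩
    x ⊗ (vertex u ⊗ (vertex v ⊗ y)) ≈⟨ ⊗-cong ∼-refl (⊗-assoc _ _ y) ⟨
    x ⊗ ((vertex u ⊗ vertex v) ⊗ y) ≈⟨ ⊗-cong ∼-refl (⊗-cong (vertex-orth u≢v) ∼-refl) ⟩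
    x ⊗ (𝟘 ⊗ y)                    ≈⟨ ⊗-cong ∼-refl (⊗-zeroˡ y) ⟩
    x ⊗ 𝟘                          ≈⟨ ⊗-zeroʳ x ⟩
    𝟘                              ∎

  pathTerm : ∀ {v w} → Path E v w → Term
  pathTerm {v} ε         = vertex v
  pathTerm ((e , _) ◅ p) = edge e ⊗ pathTerm p

  pathTerm-▻ : ∀ {v w x} (p : Path E v w) (a : Arrow E w x) →
    pathTerm (p ▻ a) ≈ᴹ pathTerm p ⊗ edge (proj₁ a)
  pathTerm-▻ ε (e , ≡.refl , ≡.refl) = ∼-trans (edge-target e) (∼-sym (source-edge e))
  pathTerm-▻ ((e , _) ◅ p) a = ∼-trans (⊗-cong ∼-refl (pathTerm-▻ p a)) (∼-sym (⊗-assoc _ _ _))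

  pathTerm-range : ∀ {v w} (p : Path E v w) → pathTerm p ⊗ vertex w ≈ᴹ pathTerm p
  pathTerm-range ε       = vertex-idem _
  pathTerm-range (a ◅ p) = ∼-trans (⊗-assoc _ _ _) (⊗-cong ∼-refl (pathTerm-range p))

  module _ {w : Vertex} (sink : Sink E w) where

    -- GhostMonomial u y: y is α* for a path α from u to the sink w. Since w emits no
    -- edge, these monomials span the right ideal generated by w.
    data GhostMonomial : Vertex → Term → Set r where
      nil  : GhostMonomial w (vertex w)
      snoc : ∀ {y} e → GhostMonomial (target e) y → GhostMonomial (source e) (y ⊗ ghost e)

    data GhostSpan : Term → Set (r Level.⊔ ℓr) where
      monomial : ∀ {u y} → GhostMonomial u y → GhostSpan y
      zero     : GhostSpan 𝟘
      add      : ∀ {x y} → GhostSpan x → GhostSpan y → GhostSpan (x ⊕ y)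
      scale    : ∀ k {x} → GhostSpan x → GhostSpan (k ⊙ x)
      resp     : ∀ {x y} → x ≈ᴹ y → GhostSpan x → GhostSpan y

    monomial-source : ∀ {u y} → GhostMonomial u y → y ⊗ vertex u ≈ᴹ y
    monomial-source nil        = vertex-idem w
    monomial-source (snoc e m) = ∼-trans (⊗-assoc _ _ _) (⊗-cong ∼-refl (ghost-source e))

    monomial-⊗-vertex : ∀ {u y} v → GhostMonomial u y → GhostSpan (y ⊗ vertex v)
    monomial-⊗-vertex {u} v m with u ≟ v
    ... | yes ≡.refl = resp (∼-sym (monomial-source m)) (monomial m)
    ... | no  u≢v    = resp (∼-sym (mismatch u≢v (monomial-source m) (vertex-idem v))) zero

    monomial-⊗-edge : ∀ {u y} f → GhostMonomial u y → GhostSpan (y ⊗ edge f)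
    monomial-⊗-edge f nil =
      resp (∼-sym (mismatch (sink f ∘ ≡.sym) (vertex-idem w) (source-edge f))) zero
    monomial-⊗-edge f (snoc {y} e m) with e ≟ f
    ... | yes ≡.refl = resp (∼-sym (∼-trans (⊗-assoc _ _ _)
            (∼-trans (⊗-cong ∼-refl (ghost-edge e)) (monomial-source m)))) (monomial m)
    ... | no  e≢f    = resp (∼-sym (∼-trans (⊗-assoc _ _ _)
            (∼-trans (⊗-cong ∼-refl (ghost-orth e≢f)) (⊗-zeroʳ y)))) zero

    monomial-⊗-ghost : ∀ {u y} f → GhostMonomial u y → GhostSpan (y ⊗ ghost f)
    monomial-⊗-ghost {u} f m with u ≟ target f
    ... | yes ≡.refl = monomial (snoc f m)
    ... | no  u≢t    = resp (∼-sym (mismatch u≢t (monomial-source m) (target-ghost f))) zero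

    span-⊗-monomialwise : ∀ g → (∀ {u y} → GhostMonomial u y → GhostSpan (y ⊗ g)) →
      ∀ {y} → GhostSpan y → GhostSpan (y ⊗ g)
    span-⊗-monomialwise g mono (monomial m) = mono m
    span-⊗-monomialwise g mono zero         = resp (∼-sym (⊗-zeroˡ g)) zero
    span-⊗-monomialwise g mono (add s t)    = resp (∼-sym (⊗-distribʳ g _ _))
      (add (span-⊗-monomialwise g mono s) (span-⊗-monomialwise g mono t))
    span-⊗-monomialwise g mono (scale k s)  = resp (∼-sym (⊙-⊗-assoc k _ g))
      (scale k (span-⊗-monomialwise g mono s))
    span-⊗-monomialwise g mono (resp x≈y s) = resp (⊗-cong x≈y ∼-refl) (span-⊗-monomialwise g mono s)

    -- The span is a right ideal: by ghost-edge and ghost-orth an edge cancels the last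
    -- ghost edge of a monomial or annihilates it, and it annihilates the monomial w
    -- because w is a sink.
    span-⊗ : ∀ {y} → GhostSpan y → ∀ t → GhostSpan (y ⊗ t)
    span-⊗ s (vertex v) = span-⊗-monomialwise _ (monomial-⊗-vertex v) s
    span-⊗ s (edge e)   = span-⊗-monomialwise _ (monomial-⊗-edge e) s
    span-⊗ s (ghost e)  = span-⊗-monomialwise _ (monomial-⊗-ghost e) s
    span-⊗ s 𝟘          = resp (∼-sym (⊗-zeroʳ _)) zero
    span-⊗ s (t ⊕ t′)   = resp (∼-sym (⊗-distribˡ _ t t′)) (add (span-⊗ s t) (span-⊗ s t′))
    span-⊗ s (t ⊗ t′)   = resp (⊗-assoc _ t t′) (span-⊗ (span-⊗ s t) t′)
    span-⊗ s (⊖ t)      = resp (∼-sym (∼-trans (⊗-cong ∼-refl (⊖-as-⊙ t)) (⊗-⊙-comm _ _ t)))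
                            (scale _ (span-⊗ s t))
    span-⊗ s (k ⊙ t)    = resp (∼-sym (⊗-⊙-comm k _ t)) (scale k (span-⊗ s t))

    module _ {w′ : Vertex} (sink′ : Sink E w′) where

      -- A ghost monomial of positive length ends in ghost e = ghost e ⊗ source e, and
      -- source e is not the sink w′.
      span-corner : ∀ {y} → GhostSpan y → ∃ λ k → y ⊗ vertex w′ ≈ᴹ k ⊙ (vertex w ⊗ vertex w′)
      span-corner (monomial nil)        = R.1# , ∼-sym (⊙-identityˡ _)
      span-corner (monomial (snoc e m)) = R.0# ,
        ∼-trans (mismatch (sink′ e) (monomial-source (snoc e m)) (vertex-idem w′)) (∼-sym (⊙-zeroˡ _))
      span-corner zero = R.0# , ∼-trans (⊗-zeroˡ _) (∼-sym (⊙-zeroˡ _))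
      span-corner (add s t) with span-corner s | span-corner t
      ... | k , p | l , q = k R.+ l ,
        ∼-trans (⊗-distribʳ _ _ _) (∼-trans (⊕-cong p q) (∼-sym (⊙-distribʳ _ k l)))
      span-corner (scale l s) with span-corner s
      ... | k , p = l R.* k ,
        ∼-trans (⊙-⊗-assoc l _ _) (∼-trans (⊙-cong R.refl p) (∼-sym (⊙-assoc l k _)))
      span-corner (resp x≈y s) with span-corner s
      ... | k , p = k , ∼-trans (⊗-cong (∼-sym x≈y) ∼-refl) p

      sink-corner : ∀ t → ∃ λ k → (vertex w ⊗ t) ⊗ vertex w′ ≈ᴹ k ⊙ (vertex w ⊗ vertex w′)
      sink-corner t = span-corner (span-⊗ (monomial nil) t)

-- The size of the matrices
module MatrixRepresentation {c ℓ₁ ℓ₂} (K : HeytingField c ℓ₁ ℓ₂) (n : ℕ) (E : FiniteGraph)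
  (iso : leavittPathAlgebra (fieldRing K) E ≅ matrixAlgebra (fieldRing K) n) where
  open CommutativeRing (fieldRing K) hiding (zero)
  open HeytingField K using (_#_; tight)
  open SemiringSum semiring using (sum-syntax; sum-cong-≋; ∑-comm; ∑-distrib-+; *-distribˡ-sum; *-distribʳ-sum)
  open CommutativeSemigroupProperties *-commutativeSemigroup using (x∙yz≈y∙xz; xy∙z≈xz∙y)
  open LinearAlgebra K
  open FiniteGraph E
  open LeftModuleMorphisms
  open _≅_ iso renaming (⟦_⟧ to φ)
  open IsLeftModuleIsomorphism isLeftModuleIsomorphism using (injective; surjective; +ᴹ-homo; 0ᴹ-homo; *ₗ-homo) renaming (⟦⟧-cong to φ-cong)
  open PathCounts
  open Paths E
  open InfinitePaths E
  open LeavittProperties (fieldRing K) E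
  open InfinitePathModule (fieldRing K) E using (combination; prefix; act-combination; act-prefix; act; act-sound; Function; guard; guard-yes; guard-no)
  open SetoidReasoning setoid

  private Term = LeavittTerm (fieldRing K) E

  -- Act on the indicator function of the degree of the prefix number j and evaluate
  -- at z and degree 0: only the term with coefficient x j survives.
  prefixes-independent : ∀ {m z} → IsInfinitePath z → (x : Vector Carrier m) →
    combination x (prefix z ∘ toℕ) ≈ᴹ 𝟘 → ∀ i → x i ≈ 0#
  prefixes-independent {m} {z} z∞ x x∼0 j = begin
    x j                              ≈⟨ *-identityʳ _ ⟨
    x j * 1#                         ≈⟨ *-congˡ (trans (value j) (guard-yes (degree ≟ℤ degree) ≡.refl)) ⟨
    x j * act (prefix z (toℕ j)) f z (+ 0)   ≈⟨ sum-single j others ⟨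
    ∑[ i < m ] (x i * act (prefix z (toℕ i)) f z (+ 0)) ≈⟨ act-combination x _ f z (+ 0) ⟨
    act (combination x (prefix z ∘ toℕ)) f z (+ 0) ≈⟨ act-sound x∼0 (λ _ _ _ → refl) z∞ (+ 0) ⟩
    0#  ∎
    where
    _≟ℤ_ = ℤ._≟_
    degree = + (suc (toℕ j) Nat.+ 0)
    h : ℤ → Carrier
    h d = guard (d ≟ℤ degree) 1#
    f : Function
    f _ = h

    value : ∀ i → act (prefix z (toℕ i)) f z (+ 0) ≈ h (+ (suc (toℕ i) Nat.+ 0))
    value i = act-prefix h z (toℕ i) 0

    others : ∀ i → i ≢ j → x i * act (prefix z (toℕ i)) f z (+ 0) ≈ 0#
    others i i≢j = trans (*-congˡ (trans (value i) (guard-no (_ ≟ℤ degree) λ eq →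
      i≢j (toℕ-injective (ℕₚ.+-cancelʳ-≡ 0 _ _ (ℕₚ.suc-injective (ℤ.+-injective eq))))))) (zeroʳ _)

  φ-combination : ∀ {m} (x : Vector Carrier m) t a b →
    φ (combination x t) a b ≈ ∑[ i < m ] (x i * φ (t i) a b)
  φ-combination {zero}  x t a b = 0ᴹ-homo a b
  φ-combination {suc m} x t a b =
    trans (+ᴹ-homo _ _ a b) (+-cong (*ₗ-homo _ _ a b) (φ-combination (x ∘ suc) (t ∘ suc) a b))

  -- The entries of n² + 1 prefixes form n² equations for the coefficients of a
  -- linear relation between them, and injectivity of φ makes the kernel trivial.
  noInfinitePath : ∀ {z} → ¬ IsInfinitePath z
  noInfinitePath {z} z∞ = ℕₚ.1+n≰n (trivialKernel⇒≤ entries trivial)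
    where
    entries : Fin (n Nat.* n) → Vector Carrier (suc (n Nat.* n))
    entries ab i = φ (prefix z (toℕ i)) (proj₁ (remQuot {n} n ab)) (proj₂ (remQuot {n} n ab))

    trivial : TrivialKernel entries
    trivial x x∈ker = prefixes-independent z∞ x (injective λ a b → begin
      φ (combination x (prefix z ∘ toℕ)) a b ≈⟨ φ-combination x (prefix z ∘ toℕ) a b ⟩
      ∑[ i < suc (n Nat.* n) ] (x i * φ (prefix z (toℕ i)) a b)
        ≡⟨ ≡.cong (λ (a , b) → ∑[ i < suc (n Nat.* n) ] (x i * φ (prefix z (toℕ i)) a b)) (remQuot-combine {n} {n} a b) ⟨
      ∑[ i < suc (n Nat.* n) ] (x i * entries (combine a b) i) ≈⟨ x∈ker (combine a b) ⟩
      0# ≈⟨ 0ᴹ-homo a b ⟨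
      φ 𝟘 a b ∎)

  acyclic : Acyclic E
  acyclic v cycle = noInfinitePath (proj₂ (cycle⇒infinitePath cycle))

  preimage : ∀ (A : Matrix (fieldRing K) n) → ∃ λ t → ∀ a b → φ t a b ≈ A a b
  preimage A with surjective A
  ... | t , φt≈A = t , φt≈A ∼-refl

  infixl 7 _·_
  _·_ : Vector Carrier n → Matrix (fieldRing K) n → Vector Carrier n
  (x · A) b = ∑[ a < n ] (x a * A a b)

  ·-assoc : ∀ x A B b → (x · matrixProduct (fieldRing K) n A B) b ≈ ((x · A) · B) b
  ·-assoc x A B b = begin
    ∑[ a < n ] (x a * ∑[ k < n ] (A a k * B k b)) ≈⟨ sum-cong-≋ (λ a → *-distribˡ-sum (x a) (λ k → A a k * B k b)) ⟩
    ∑[ a < n ] ∑[ k < n ] (x a * (A a k * B k b)) ≈⟨ ∑-comm (λ a k → x a * (A a k * B k b)) ⟩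
    ∑[ k < n ] ∑[ a < n ] (x a * (A a k * B k b)) ≈⟨ sum-cong-≋ (λ k → sum-cong-≋ λ a → *-assoc (x a) (A a k) (B k b)) ⟨
    ∑[ k < n ] ∑[ a < n ] (x a * A a k * B k b)   ≈⟨ sum-cong-≋ (λ k → *-distribʳ-sum (B k b) (λ a → x a * A a k)) ⟨
    ∑[ k < n ] (∑[ a < n ] (x a * A a k) * B k b) ∎

  ·-φ-⊗ : ∀ x s t b → (x · φ (s ⊗ t)) b ≈ ((x · φ s) · φ t) b
  ·-φ-⊗ x s t b = trans (sum-cong-≋ λ a → *-congˡ (∙-homo s t a b)) (·-assoc x (φ s) (φ t) b)

  ·-φ-cong : ∀ x {s t} → s ≈ᴹ t → ∀ b → (x · φ s) b ≈ (x · φ t) b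
  ·-φ-cong x s≈t b = sum-cong-≋ λ a → *-congˡ (φ-cong s≈t a b)

  matrixUnit : Fin n → Fin n → Matrix (fieldRing K) n
  matrixUnit i j a b = δ a i * δ b j

  sandwich-matrixUnit : ∀ A B i j a b →
    matrixProduct (fieldRing K) n (matrixProduct (fieldRing K) n A (matrixUnit i j)) B a b ≈ A a i * B j b
  sandwich-matrixUnit A B i j a b = begin
    ∑[ l < n ] (∑[ k < n ] (A a k * (δ k i * δ l j)) * B l b)
      ≈⟨ sum-cong-≋ (λ l → *-congʳ (sum-cong-≋ λ k → *-assoc (A a k) (δ k i) (δ l j))) ⟨
    ∑[ l < n ] (∑[ k < n ] (A a k * δ k i * δ l j) * B l b)
      ≈⟨ sum-cong-≋ (λ l → *-congʳ (*-distribʳ-sum (δ l j) (λ k → A a k * δ k i))) ⟨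
    ∑[ l < n ] (∑[ k < n ] (A a k * δ k i) * δ l j * B l b)
      ≈⟨ sum-cong-≋ (λ l → *-congʳ {B l b} (*-congʳ {δ l j} (sum-δʳ (A a) i))) ⟩
    ∑[ l < n ] (A a i * δ l j * B l b)  ≈⟨ sum-cong-≋ (λ l → xy∙z≈xz∙y (A a i) (δ l j) (B l b)) ⟩
    ∑[ l < n ] (A a i * B l b * δ l j)  ≈⟨ sum-δʳ (λ l → A a i * B l b) j ⟩
    A a i * B j b                       ∎

  -- Apply sink-corner to a preimage t of a matrix unit: the left side is the entry
  -- of φ(w)φ(t)φ(w′) at a, b.
  sinks-rankOne : ∀ {w w′} → Sink E w → Sink E w′ → ∀ i j → ∃ λ k → ∀ a b →
    φ (vertex w) a i * φ (vertex w′) j b ≈ k * φ (vertex w ⊗ vertex w′) a b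
  sinks-rankOne {w} {w′} sink sink′ i j with preimage (matrixUnit i j)
  ... | t , φt≈ with sink-corner sink sink′ t
  ...   | k , corner = k , λ a b → begin
    φ (vertex w) a i * φ (vertex w′) j b   ≈⟨ sandwich-matrixUnit (φ (vertex w)) (φ (vertex w′)) i j a b ⟨
    _                                      ≈⟨ sum-cong-≋ (λ l → *-congʳ (sum-cong-≋ λ m → *-congˡ (φt≈ m l))) ⟨
    _                                      ≈⟨ sum-cong-≋ (λ l → *-congʳ (∙-homo (vertex w) t a l)) ⟨
    _                                      ≈⟨ ∙-homo (vertex w ⊗ t) (vertex w′) a b ⟨
    φ ((vertex w ⊗ t) ⊗ vertex w′) a b     ≈⟨ φ-cong corner a b ⟩
    φ (k ⊙ (vertex w ⊗ vertex w′)) a b     ≈⟨ *ₗ-homo k _ a b ⟩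
    k * φ (vertex w ⊗ vertex w′) a b       ∎

  sink? : ∀ v → Dec (Sink E v)
  sink? v = all? λ e → ¬? (source e ≟ v)

  module _ (x : Vector Carrier n) where

    Kills : Term → Set ℓ₁
    Kills t = ∀ b → (x · φ t) b ≈ 0#

    kills-cong : ∀ {s t} → s ≈ᴹ t → Kills s → Kills t
    kills-cong s≈t xs b = trans (sym (·-φ-cong x s≈t b)) (xs b)

    kills-⊗ : ∀ {s} → Kills s → ∀ t → Kills (s ⊗ t)
    kills-⊗ {s} xs t b = trans (·-φ-⊗ x s t b) (sum-zero λ a → trans (*-congʳ (xs a)) (zeroˡ (φ t a b)))

    kills-𝟘 : Kills 𝟘
    kills-𝟘 b = sum-zero λ a → trans (*-congˡ (0ᴹ-homo a b)) (zeroʳ (x a))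

    kills-⊕ : ∀ {s t} → Kills s → Kills t → Kills (s ⊕ t)
    kills-⊕ {s} {t} xs xt b = begin
      (x · φ (s ⊕ t)) b                                ≈⟨ sum-cong-≋ (λ a → trans (*-congˡ (+ᴹ-homo s t a b)) (distribˡ _ _ _)) ⟩
      ∑[ a < n ] (x a * φ s a b + x a * φ t a b)       ≈⟨ ∑-distrib-+ (λ a → x a * φ s a b) _ ⟩
      (x · φ s) b + (x · φ t) b                        ≈⟨ +-cong (xs b) (xt b) ⟩
      0# + 0#                                          ≈⟨ +-identityˡ 0# ⟩
      0#                                               ∎

    kills-⊙ : ∀ k {t} → Kills t → Kills (k ⊙ t)
    kills-⊙ k {t} xt b = begin
      (x · φ (k ⊙ t)) b                 ≈⟨ sum-cong-≋ (λ a → trans (*-congˡ (*ₗ-homo k t a b)) (x∙yz≈y∙xz (x a) k _)) ⟩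
      ∑[ a < n ] (k * (x a * φ t a b))  ≈⟨ *-distribˡ-sum k (λ a → x a * φ t a b) ⟨
      k * (x · φ t) b                   ≈⟨ *-congˡ (xt b) ⟩
      k * 0#                            ≈⟨ zeroʳ k ⟩
      0#                                ∎

    -- Every generator begins with a vertex, so the row vectors killing all vertices
    -- kill every term.
    kills-all : (∀ v → Kills (vertex v)) → ∀ t → Kills t
    kills-all xv (vertex v) = xv v
    kills-all xv (edge e)   = kills-cong (source-edge e) (kills-⊗ (xv (source e)) (edge e))
    kills-all xv (ghost e)  = kills-cong (target-ghost e) (kills-⊗ (xv (target e)) (ghost e))
    kills-all xv 𝟘          = kills-𝟘
    kills-all xv (s ⊕ t)    = kills-⊕ (kills-all xv s) (kills-all xv t)
    kills-all xv (s ⊗ t)    = kills-⊗ (kills-all xv s) t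
    kills-all xv (⊖ t)      = kills-cong (∼-sym (⊖-as-⊙ t)) (kills-⊙ _ (kills-all xv t))
    kills-all xv (k ⊙ t)    = kills-⊙ k (kills-all xv t)

    -- The identity matrix is in the image of φ.
    kills-vertices⇒zero : (∀ v → Kills (vertex v)) → ∀ i → x i ≈ 0#
    kills-vertices⇒zero xv i with preimage δ
    ... | t , φt≈δ = begin
      x i            ≈⟨ sum-δʳ x i ⟨
      (x · δ) i      ≈⟨ sum-cong-≋ (λ a → *-congˡ (φt≈δ a i)) ⟨
      (x · φ t) i    ≈⟨ kills-all xv t i ⟩
      0#             ∎

    kills-⊗-∑ : ∀ s (h : Edge → Term) es → (∀ {e} → e ∈ es → Kills (s ⊗ h e)) →
      Kills (s ⊗ foldr _⊕_ 𝟘 (map h es))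
    kills-⊗-∑ s h []       xs = kills-cong (∼-sym (⊗-zeroʳ s)) kills-𝟘
    kills-⊗-∑ s h (e ∷ es) xs = kills-cong (∼-sym (⊗-distribˡ s _ _))
      (kills-⊕ (xs (here ≡.refl)) (kills-⊗-∑ s h es (xs ∘ there)))

    module _ (kills-sinks : ∀ {v w} → Sink E w → (p : Path E v w) → Kills (pathTerm p)) where

      -- Descends along the paths: if w is not a sink, then p = ∑ (p e) e* over the edges
      -- e leaving w, and the target of e is strictly later than w in the order of the acyclic graph.
      kills-paths : ∀ {v w} → Acc (flip (TransClosure (Arrow E))) w → (p : Path E v w) → Kills (pathTerm p)
      kills-paths {v} {w} (acc rec) p with sink? w
      ... | yes sink   = kills-sinks sink p
      ... | no notSink = kills-cong
        (∼-trans (⊗-cong ∼-refl (∼-sym (vertex-sum w notSink))) (pathTerm-range p))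
        (kills-⊗-∑ (pathTerm p) (λ e → edge e ⊗ ghost e) (outgoing E w) continue)
        where
        continue : ∀ {e} → e ∈ outgoing E w → Kills (pathTerm p ⊗ (edge e ⊗ ghost e))
        continue {e} e∈ =
          let a = e , proj₂ (∈-filter⁻ (λ e → source e ≟ w) {xs = allFin #edges} e∈) , ≡.refl
          in kills-cong (⊗-assoc _ _ _)
               (kills-⊗ (kills-cong (pathTerm-▻ p a) (kills-paths (rec [ a ]) (p ▻ a))) (ghost e))

      kills-sinks⇒zero : ∀ i → x i ≈ 0#
      kills-sinks⇒zero = kills-vertices⇒zero λ v → kills-paths (acyclic⇒noetherian acyclic v) ε

    kills-zero-vertex : ∀ {v w} → (∀ a b → φ (vertex w) a b ≈ 0#) → (p : Path E v w) → Kills (pathTerm p)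
    kills-zero-vertex w≈0 p = kills-cong (pathTerm-range p) λ b →
      trans (·-φ-⊗ x (pathTerm p) _ b) (sum-zero λ a → trans (*-congˡ (w≈0 a b)) (zeroʳ _))

  module _ {w : Vertex} (sink : Sink E w) {a₀ b₀ : Fin n} (q#0 : φ (vertex w) a₀ b₀ # 0#) where
    private
      Q : Matrix (fieldRing K) n
      Q = φ (vertex w)

      q q⁻¹ : Carrier
      q   = Q a₀ b₀
      q⁻¹ = proj₁ (invertible q#0)

      q-cancel : ∀ y → q⁻¹ * (q * y) ≈ y
      q-cancel y = trans (sym (*-assoc _ _ _)) (trans (*-congʳ (proj₂ (invertible q#0))) (*-identityˡ y))

    -- The corner between different sinks vanishes, because w w′ = 0.
    other-sinks-zero : ∀ {w′} → Sink E w′ → w ≢ w′ → ∀ a b → φ (vertex w′) a b ≈ 0#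
    other-sinks-zero {w′} sink′ w≢w′ a b with sinks-rankOne sink sink′ b₀ a
    ... | k , rankOne = begin
      φ (vertex w′) a b                      ≈⟨ q-cancel _ ⟨
      q⁻¹ * (q * φ (vertex w′) a b)          ≈⟨ *-congˡ (rankOne a₀ b) ⟩
      q⁻¹ * (k * φ (vertex w ⊗ vertex w′) a₀ b) ≈⟨ *-congˡ (*-congˡ (trans (φ-cong (vertex-orth w≢w′) a₀ b) (0ᴹ-homo a₀ b))) ⟩
      q⁻¹ * (k * 0#)                         ≈⟨ *-congˡ (zeroʳ k) ⟩
      q⁻¹ * 0#                               ≈⟨ zeroʳ q⁻¹ ⟩
      0#                                     ∎

    -- With a₀ fixed, sinks-rankOne says that the row a of Q is proportional to row a₀;
    -- comparing column b₀ gives the factor Q a b₀ divided by q.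
    sink-rankOne : ∀ a b → Q a b ≈ Q a b₀ * (q⁻¹ * Q a₀ b)
    sink-rankOne a b with sinks-rankOne sink sink b₀ a
    ... | k , rankOne = begin
      Q a b                        ≈⟨ q-cancel _ ⟨
      q⁻¹ * (q * Q a b)            ≈⟨ *-congˡ (trans (rankOne a₀ b) (*-congˡ (idem a₀ b))) ⟩
      q⁻¹ * (k * Q a₀ b)           ≈⟨ *-congˡ (*-congʳ k≈) ⟩
      q⁻¹ * (Q a b₀ * Q a₀ b)      ≈⟨ x∙yz≈y∙xz _ _ _ ⟩
      Q a b₀ * (q⁻¹ * Q a₀ b)      ∎
      where
      idem : ∀ a b → φ (vertex w ⊗ vertex w) a b ≈ Q a b
      idem = φ-cong (vertex-idem w)

      k≈ : k ≈ Q a b₀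
      k≈ = begin
        k               ≈⟨ q-cancel k ⟨
        q⁻¹ * (q * k)   ≈⟨ *-congˡ (*-comm q k) ⟩
        q⁻¹ * (k * q)   ≈⟨ *-congˡ (trans (rankOne a₀ b₀) (*-congˡ (idem a₀ b₀))) ⟨
        q⁻¹ * (q * Q a b₀) ≈⟨ q-cancel _ ⟩
        Q a b₀          ∎

    kills-if-column : ∀ x {v} (p : Path E v w) → (x · φ (pathTerm p)) b₀ ≈ 0# → Kills x (pathTerm p)
    kills-if-column x p column≈0 = kills-cong x (pathTerm-range p) λ b → begin
      (x · φ (pathTerm p ⊗ vertex w)) b     ≈⟨ ·-φ-⊗ x (pathTerm p) (vertex w) b ⟩
      ((x · φ (pathTerm p)) · Q) b          ≈⟨ sum-cong-≋ (λ a → trans (*-congˡ (sink-rankOne a b)) (sym (*-assoc _ _ _))) ⟩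
      ∑[ a < n ] ((x · φ (pathTerm p)) a * Q a b₀ * (q⁻¹ * Q a₀ b)) ≈⟨ *-distribʳ-sum _ (λ a → (x · φ (pathTerm p)) a * Q a b₀) ⟨
      ((x · φ (pathTerm p)) · Q) b₀ * (q⁻¹ * Q a₀ b) ≈⟨ *-congʳ (·-φ-⊗ x (pathTerm p) (vertex w) b₀) ⟨
      (x · φ (pathTerm p ⊗ vertex w)) b₀ * (q⁻¹ * Q a₀ b) ≈⟨ *-congʳ (trans (·-φ-cong x (pathTerm-range p) b₀) column≈0) ⟩
      0# * (q⁻¹ * Q a₀ b)                   ≈⟨ zeroˡ _ ⟩
      0#                                    ∎

    -- The unknowns are the entries of a row vector x; each listed path α gives the
    -- equation that x annihilates column b₀ of φ(α).
    size-≤-maxPaths-via-sink : n ≤ maxPaths #edges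
    size-≤-maxPaths-via-sink with allPaths acyclic w
    ... | ps , ps≤ , complete = ℕₚ.≤-trans (trivialKernel⇒≤ columns trivial) ps≤
      where
      columns : Fin (length ps) → Vector Carrier n
      columns j a = φ (pathTerm (proj₂ (lookup ps j))) a b₀

      trivial : TrivialKernel columns
      trivial x x∈ker = kills-sinks⇒zero x kills-sinks
        where
        kills-sinks : ∀ {v w′} → Sink E w′ → (p : Path E v w′) → Kills x (pathTerm p)
        kills-sinks {v} {w′} sink′ p with w ≟ w′
        ... | no  w≢w′   = kills-zero-vertex x (other-sinks-zero sink′ w≢w′) p
        ... | yes ≡.refl = kills-if-column x p
          (≡.subst (λ (vp : PathEndingIn E w) → (x · φ (pathTerm (proj₂ vp))) b₀ ≈ 0#)
             (≡.sym (lookup-index (complete p))) (x∈ker (index (complete p))))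

  -- If n exceeded the bound, no entry of φ at a sink could be apart from zero, so
  -- all sinks would be mapped to zero. Then every row vector of length n vanishes:
  -- the system without equations has trivial kernel.
  size-≤-maxPaths : n ≤ maxPaths #edges
  size-≤-maxPaths with n ℕₚ.≤? maxPaths #edges
  ... | yes n≤ = n≤
  ... | no  n≰ = ℕₚ.≤-trans (trivialKernel⇒≤ {zero} (λ ()) λ x _ → kills-sinks⇒zero x λ sink p →
                   kills-zero-vertex x (λ a b → proj₁ (tight _ _) λ q#0 → n≰ (size-≤-maxPaths-via-sink sink q#0)) p) z≤n

corollary4p13 : ∀ {c ℓ₁ ℓ₂} (K : HeytingField c ℓ₁ ℓ₂) (n : ℕ) → 1 ≤ n →
    (E : FiniteGraph) →
    leavittPathAlgebra (fieldRing K) E ≅ matrixAlgebra (fieldRing K) n →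
    ∃ λ N → IsMaxEdges n N × N ≤ FiniteGraph.#edges E
corollary4p13 K (suc n) _ E iso with PathCounts.maxPaths-bracket n
... | N , lower , upper =
  N , ((PathCounts.maxPaths N , PathCounts.isSP*-maxPaths N , lower) , maximal)
    , N≤#edges
  where
  open PathCounts
  maximal : ∀ k → (∃ λ m → IsSP* k m × m ≤ suc n) → k ≤ N
  maximal k (m , (_ , m-upper) , m≤n) =
    maxPaths-cancel-≤ k (ℕₚ.≤-trans (m-upper _ (proj₁ (isSP*-maxPaths k))) m≤n) upper

  N≤#edges : N ≤ FiniteGraph.#edges E
  N≤#edges = maxPaths-cancel-≤ N lower
    (ℕₚ.≤-<-trans (MatrixRepresentation.size-≤-maxPaths K (suc n) E iso) (maxPaths-<-suc (FiniteGraph.#edges E)))
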